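{- Let $M=(E,\mathcal{I})$ be a matroid of rank $n$. For $0\le k\le n$, let $I_k$ be the number of independent sets of $M$ of rank $k$ (that is, with $k$ elements). Then $I_k^2\ge I_{k-1}I_{k+1}$ for all $2\le k\le n-1$.
   Context: $M=(E,\mathcal I)$ denotes a matroid on a finite ground set $E$ with collection of independent sets $\mathcal I$. -}

module Defs where

open import Data.Fin.Subset using (Subset; inside; outside; ⊥; _∈_; _∉_; _⊆_; _∪_; ⁅_⁆; ∣_∣)
open import Data.List.Base using (List; []; _∷_; _++_; map; filter; length)
open import Data.List.Extrema.Nat using (max)
open import Data.List.Membership.Propositional using () renaming (_∈_ to _∈ˡ_)
open import Data.List.Membership.Propositional.Properties
  using (∈-map⁺; ∈-map⁻; ∈-++⁺ˡ; ∈-++⁺ʳ)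
open import Data.List.Relation.Unary.Any using (here)
open import Data.List.Relation.Unary.All using ([])
open import Data.List.Relation.Unary.AllPairs using ([]; _∷_)
open import Data.List.Relation.Unary.Unique.Propositional using (Unique)
open import Data.List.Relation.Unary.Unique.Propositional.Properties using (map⁺; ++⁺)
open import Data.Nat.Base using (ℕ; zero; suc; _<_)
open import Data.Nat.Properties using (_≟_)
open import Data.Product.Base using (∃; _×_; _,_)
open import Data.Vec.Base using ([]; _∷_)
open import Data.Vec.Properties using (∷-injectiveʳ)
open import Level using (Level) renaming (suc to lsuc)
open import Relation.Binary.PropositionalEquality.Core using (_≡_; refl; trans; sym)
open import Relation.Unary using (Pred; Decidable)

-- The ground set is Fin m.  Decidability of independence is what makes
-- the collection of independent sets a finite set that can be counted;
-- classically it is automatic.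
record Matroid (m : ℕ) (ℓ : Level) : Set (lsuc ℓ) where
  field
    Indep        : Pred (Subset m) ℓ
    indep?       : Decidable Indep
    indep-⊥      : Indep ⊥
    hereditary   : ∀ {S T} → S ⊆ T → Indep T → Indep S
    augmentation : ∀ {S T} → Indep S → Indep T → ∣ S ∣ < ∣ T ∣ →
                   ∃ λ x → x ∈ T × x ∉ S × Indep (S ∪ ⁅ x ⁆)

allSubsets : ∀ m → List (Subset m)
allSubsets zero    = [] ∷ []
allSubsets (suc m) = map (inside ∷_) (allSubsets m) ++ map (outside ∷_) (allSubsets m)

allSubsets-complete : ∀ {m} (S : Subset m) → S ∈ˡ allSubsets m
allSubsets-complete []            = here refl
allSubsets-complete (inside  ∷ S) = ∈-++⁺ˡ (∈-map⁺ (inside ∷_) (allSubsets-complete S))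
allSubsets-complete (outside ∷ S) =
  ∈-++⁺ʳ (map (inside ∷_) (allSubsets _)) (∈-map⁺ (outside ∷_) (allSubsets-complete S))

allSubsets-unique : ∀ m → Unique (allSubsets m)
allSubsets-unique zero    = [] ∷ []
allSubsets-unique (suc m) =
  ++⁺ (map⁺ ∷-injectiveʳ (allSubsets-unique m))
      (map⁺ ∷-injectiveʳ (allSubsets-unique m))
      λ (p , q) → case (∈-map⁻ (inside ∷_) p) (∈-map⁻ (outside ∷_) q)
  where
  open import Data.Empty using () renaming (⊥ to Empty)
  case : ∀ {S : Subset (suc m)} →
         (∃ λ T → T ∈ˡ allSubsets m × S ≡ inside ∷ T) →
         (∃ λ T → T ∈ˡ allSubsets m × S ≡ outside ∷ T) → Empty
  case (_ , _ , e) (_ , _ , e′) with trans (sym e) e′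
  ... | ()

module _ {m : ℕ} {ℓ : Level} (M : Matroid m ℓ) where
  open Matroid M

  independentSets : List (Subset m)
  independentSets = filter indep? (allSubsets m)

  rank : ℕ
  rank = max 0 (map ∣_∣ independentSets)

  numIndep : ℕ → ℕ
  numIndep k = length (filter (λ S → ∣ S ∣ ≟ k) independentSets)

{-# OPTIONS --safe #-}
module Submission where

-- Fix a weight t > 0 for an extra variable and let G_k(t) be the total weight of all
-- sequences of k steps, each of which either uses the extra variable (weight t) or adds a
-- new element keeping the set independent (weight 1).  Since G_k(0) = k! I_k, it is enough
-- to prove G_k G_{k+2} ≤ G_{k+1}² for every t > 0 and let t → 0; the resulting
-- (k+1) I_{k+1}² ≥ (k+2) I_k I_{k+2} is stronger than the claim.
-- This log-concavity is an instance of the statement that the Hessians of the associated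
-- polynomials satisfy a reversed Cauchy–Schwarz inequality.  For two steps this holds because
-- being parallel is an equivalence relation on the elements that can be added (this is where
-- augmentation enters).  For more steps the Hessian is the weighted sum of the Hessians of
-- the contractions, and their inequalities say that the associated Markov operator T
-- satisfies T² ≥ T; as its eigenvalue 1 is simple, T is nonpositive on the complement of the
-- constants.
open import Defs
open import Algebra.Bundles using (CommutativeRing)
import Data.Nat.Properties as ℕ
import Algebra.Properties.Semiring.Sum ℕ.+-*-semiring as ℕ∑
open import Data.Bool.Base using (true; false; if_then_else_)
open import Data.Fin.Base using (Fin; zero; suc)
import Data.Fin.Properties as Fin
open import Data.Fin.Subset using (Subset; _∈_; _∉_; _⊆_; _∪_; ⁅_⁆; ∣_∣; ⊥)
open import Data.Fin.Subset.Properties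
  using ( _∈?_; _⊆?_; ⊆-refl; ⊥⊆; drop-∷-⊆; p⊆q⇒∣p∣≤∣q∣; ∣⊥∣≡0; x∈⁅x⁆; x∈⁅y⁆⇒x≡y
        ; x∈p∪q⁻; p⊆p∪q; q⊆p∪q; ∪-assoc; ∪-comm; ∪-identityʳ)
open import Data.List.Base as List using (List; []; _∷_)
open import Data.List.Membership.Propositional using () renaming (_∈_ to _∈ˡ_)
open import Data.List.Properties using (map-cong)
open import Data.List.Relation.Unary.All as All using (All)
open import Data.List.Relation.Unary.AllPairs using (_∷_)
open import Data.List.Relation.Unary.Any using (here; there)
open import Data.List.Relation.Unary.Unique.Propositional using (Unique)
open import Data.Nat.Base as ℕ using (ℕ; zero; suc; z≤n; s≤s)
open import Data.Nat.ListAction using () renaming (sum to sumˡ)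
open import Data.Product.Base using (∃; _×_; _,_; proj₁; proj₂)
open import Data.Sum.Base using (inj₁; inj₂)
open import Data.Vec.Base as Vec using ([]; _∷_)
open import Function.Base using (_∘_)
open import Level using (Level)
open import Relation.Binary.PropositionalEquality
  using (_≡_; _≢_; refl; sym; trans; cong; cong₂; subst; subst₂; module ≡-Reasoning)
open import Relation.Nullary using (Dec; does; yes; no; contradiction; ¬_; ¬?; _×-dec_)
open import Relation.Nullary.Decidable using (dec-true; dec-false; dec⇒maybe)
open import Relation.Unary using (Pred; Decidable)

-- Indicator functions and elementary facts on finite subsets.

indicator : ∀ {p} {P : Set p} → Dec P → ℕ
indicator (yes _) = 1
indicator (no _)  = 0

indicator≤1 : ∀ {p} {P : Set p} (P? : Dec P) → indicator P? ℕ.≤ 1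
indicator≤1 (yes _) = s≤s z≤n
indicator≤1 (no _)  = z≤n

indicator-false : ∀ {p} {P : Set p} (P? : Dec P) → ¬ P → indicator P? ≡ 0
indicator-false (yes p) ¬p = contradiction p ¬p
indicator-false (no _)  ¬p = refl

indicator-true : ∀ {p} {P : Set p} (P? : Dec P) → P → indicator P? ≡ 1
indicator-true (yes _) p = refl
indicator-true (no ¬p) p = contradiction p ¬p

indicator-⇔ : ∀ {p q} {P : Set p} {Q : Set q} (P? : Dec P) (Q? : Dec Q) →
              (P → Q) → (Q → P) → indicator P? ≡ indicator Q?
indicator-⇔ (yes p) Q? f g = sym (indicator-true Q? (f p))
indicator-⇔ (no ¬p) Q? f g = sym (indicator-false Q? (¬p ∘ g))

indicator-× : ∀ {p q} {P : Set p} {Q : Set q} (P? : Dec P) (Q? : Dec Q) →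
              indicator P? ℕ.* indicator Q? ≡ indicator (P? ×-dec Q?)
indicator-× (yes _) (yes _) = refl
indicator-× (yes _) (no _)  = refl
indicator-× (no _)  _       = refl

indicator-idem : ∀ {p} {P : Set p} (P? : Dec P) → indicator P? ℕ.* indicator P? ≡ indicator P?
indicator-idem (yes _) = refl
indicator-idem (no _)  = refl

∣p∪⁅x⁆∣ : ∀ {m} (S : Subset m) {i} → i ∉ S → ∣ S ∪ ⁅ i ⁆ ∣ ≡ suc ∣ S ∣
∣p∪⁅x⁆∣ (true  ∷ S) {zero}  i∉S = contradiction Vec.here i∉S
∣p∪⁅x⁆∣ (false ∷ S) {zero}  i∉S = cong (suc ∘ ∣_∣) (∪-identityʳ S)
∣p∪⁅x⁆∣ (true  ∷ S) {suc i} i∉S = cong suc (∣p∪⁅x⁆∣ S (i∉S ∘ Vec.there))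
∣p∪⁅x⁆∣ (false ∷ S) {suc i} i∉S = ∣p∪⁅x⁆∣ S (i∉S ∘ Vec.there)

∪-swapʳ : ∀ {m} (S T U : Subset m) → (S ∪ T) ∪ U ≡ (S ∪ U) ∪ T
∪-swapʳ S T U = trans (∪-assoc S T U) (trans (cong (S ∪_) (∪-comm T U)) (sym (∪-assoc S U T)))

∪-least : ∀ {m} {S T U : Subset m} → S ⊆ U → T ⊆ U → S ∪ T ⊆ U
∪-least {S = S} {T} S⊆U T⊆U x∈ with x∈p∪q⁻ S T x∈
... | inj₁ x∈S = S⊆U x∈S
... | inj₂ x∈T = T⊆U x∈T

⁅⁆-⊆ : ∀ {m} {i : Fin m} {U : Subset m} → i ∈ U → ⁅ i ⁆ ⊆ U
⁅⁆-⊆ {i = i} {U} i∈U x∈ = subst (_∈ U) (sym (x∈⁅y⁆⇒x≡y i x∈)) i∈U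

-- One-element extensions of independent sets, and parallel elements.

module Extensions {m : ℕ} {ℓ : Level} (M : Matroid m ℓ) where
  open Matroid M

  Extends : Subset m → Fin m → Set ℓ
  Extends S i = i ∉ S × Indep (S ∪ ⁅ i ⁆)

  extends? : ∀ S i → Dec (Extends S i)
  extends? S i = ¬? (i ∈? S) ×-dec indep? (S ∪ ⁅ i ⁆)

  ∉-⊆ : ∀ {S T : Subset m} {i} → S ⊆ T → i ∉ T → i ∉ S
  ∉-⊆ S⊆T i∉T i∈S = i∉T (S⊆T i∈S)

  extends-⊆ : ∀ {S i j} → Extends (S ∪ ⁅ i ⁆) j → Extends S j
  extends-⊆ {S} {i} {j} (j∉ , indep) = ∉-⊆ (p⊆p∪q ⁅ i ⁆) j∉ ,
    hereditary (∪-least (p⊆p∪q ⁅ j ⁆ ∘ p⊆p∪q ⁅ i ⁆) (q⊆p∪q (S ∪ ⁅ i ⁆) ⁅ j ⁆)) indep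

  extends-swap : ∀ {S i j} → Extends S i → Extends (S ∪ ⁅ i ⁆) j → Extends (S ∪ ⁅ j ⁆) i
  extends-swap {S} {i} {j} (i∉S , _) (j∉ , indep) = i∉ , subst Indep (∪-swapʳ S ⁅ i ⁆ ⁅ j ⁆) indep
    where
    i∉ : i ∉ S ∪ ⁅ j ⁆
    i∉ i∈ with x∈p∪q⁻ S ⁅ j ⁆ i∈
    ... | inj₁ i∈S = i∉S i∈S
    ... | inj₂ i∈j = j∉ (q⊆p∪q S ⁅ i ⁆ (subst (_∈ ⁅ i ⁆) (x∈⁅y⁆⇒x≡y j i∈j) (x∈⁅x⁆ i)))

  -- Parallelism of non-loops in the contraction by S. As i is no longer new in `S ∪ ⁅ i ⁆`, every
  -- element that extends S is parallel to itself.
  Parallel : Subset m → Fin m → Fin m → Set ℓ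
  Parallel S i j = Extends S i × Extends S j × ¬ Extends (S ∪ ⁅ i ⁆) j

  parallel? : ∀ S i j → Dec (Parallel S i j)
  parallel? S i j = extends? S i ×-dec (extends? S j ×-dec ¬? (extends? (S ∪ ⁅ i ⁆) j))

  parallel-sym : ∀ {S i j} → Parallel S i j → Parallel S j i
  parallel-sym (ei , ej , ¬e) = ej , ei , λ e → ¬e (extends-swap ej e)

  -- If i and k could be added together, augmentation would enlarge `S ∪ ⁅ j ⁆` by an element of
  -- `S ∪ ⁅ i ⁆ ∪ ⁅ k ⁆`. This can only be i or k, and each contradicts one of the two given
  -- parallelisms.
  parallel-trans : ∀ {S i j k} → Parallel S i j → Parallel S j k → Parallel S i k
  parallel-trans {S} {i} {j} {k} (ei , ej , ¬eij) (_ , ek , ¬ejk) = ei , ek , ¬eik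
    where
    ¬eik : ¬ Extends (S ∪ ⁅ i ⁆) k
    ¬eik (k∉ , indep) with augmentation (proj₂ ej) indep
      (ℕ.≤-reflexive (trans (cong suc (∣p∪⁅x⁆∣ S (proj₁ ej)))
        (sym (trans (∣p∪⁅x⁆∣ (S ∪ ⁅ i ⁆) k∉) (cong suc (∣p∪⁅x⁆∣ S (proj₁ ei)))))))
    ... | x , x∈ , x∉ , indep′ with x∈p∪q⁻ (S ∪ ⁅ i ⁆) ⁅ k ⁆ x∈
    ...   | inj₂ x∈k = ¬ejk (subst (Extends (S ∪ ⁅ j ⁆)) (x∈⁅y⁆⇒x≡y k x∈k) (x∉ , indep′))
    ...   | inj₁ x∈Si with x∈p∪q⁻ S ⁅ i ⁆ x∈Si
    ...     | inj₁ x∈S = x∉ (p⊆p∪q ⁅ j ⁆ x∈S)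
    ...     | inj₂ x∈i = ¬eij (extends-swap ej (subst (Extends (S ∪ ⁅ j ⁆)) (x∈⁅y⁆⇒x≡y i x∈i) (x∉ , indep′)))

  χ : Subset m → Fin m → ℕ
  χ S i = indicator (extends? S i)

  χ-comm : ∀ S i j → χ S i ℕ.* χ (S ∪ ⁅ i ⁆) j ≡ χ S j ℕ.* χ (S ∪ ⁅ j ⁆) i
  χ-comm S i j = trans (indicator-× (extends? S i) (extends? (S ∪ ⁅ i ⁆) j))
    (trans (indicator-⇔ _ _ (λ (p , q) → extends-⊆ q , extends-swap p q) (λ (p , q) → extends-⊆ q , extends-swap p q))
      (sym (indicator-× (extends? S j) (extends? (S ∪ ⁅ j ⁆) i))))

  -- Two elements that extend S are either addable together or parallel. As matrices: the rank-one
  -- matrix of χ is the two-step Hessian plus the matrix of parallelism.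
  χ-split : ∀ S i j → χ S i ℕ.* χ S j ≡ χ S i ℕ.* χ (S ∪ ⁅ i ⁆) j ℕ.+ indicator (parallel? S i j)
  χ-split S i j = lemma (extends? S i) (extends? S j) (extends? (S ∪ ⁅ i ⁆) j) extends-⊆
    where
    lemma : ∀ {p q s} {P : Set p} {Q : Set q} {R : Set s} (P? : Dec P) (Q? : Dec Q) (R? : Dec R) → (R → Q) →
      indicator P? ℕ.* indicator Q? ≡ indicator P? ℕ.* indicator R? ℕ.+ indicator (P? ×-dec (Q? ×-dec ¬? R?))
    lemma (no _)  _       _       R→Q = refl
    lemma (yes _) (yes _) (yes _) R→Q = refl
    lemma (yes _) (yes _) (no _)  R→Q = refl
    lemma (yes _) (no ¬q) (yes r) R→Q = contradiction (R→Q r) ¬q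
    lemma (yes _) (no _)  (no _)  R→Q = refl

  -- Counts the sequences of k successive additions to S; this is the walk sum G_k at t = 0.
  orderedExtensions : ℕ → Subset m → ℕ
  orderedExtensions zero    S = 1
  orderedExtensions (suc k) S = ℕ∑.sum (λ i → χ S i ℕ.* orderedExtensions k (S ∪ ⁅ i ⁆))

  -- Index zero stands for the homogenising variable of weight t, which leaves S unchanged.
  extend : Subset m → Fin (suc m) → Subset m
  extend S zero    = S
  extend S (suc i) = S ∪ ⁅ i ⁆

  extend-comm : ∀ S a b → extend (extend S a) b ≡ extend (extend S b) a
  extend-comm S zero    zero    = refl
  extend-comm S zero    (suc j) = refl
  extend-comm S (suc i) zero    = refl
  extend-comm S (suc i) (suc j) = ∪-swapʳ S ⁅ i ⁆ ⁅ j ⁆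

-- Rational arithmetic, the Archimedean property and finite sums.

module RationalForms where

  import Data.Integer.Base as ℤ
  import Data.Integer.Properties as ℤ
  open import Data.Rational hiding (∣_∣)
  open import Data.Rational.Properties
  import Data.Rational.Unnormalised.Base as ℚᵘ
  import Data.Rational.Unnormalised.Properties as ℚᵘ
  open import Tactic.RingSolver using (solve-∀)
  open import Tactic.RingSolver.Core.AlmostCommutativeRing
    using (AlmostCommutativeRing; fromCommutativeRing)
  open import Algebra.Properties.Semiring.Sum (CommutativeRing.semiring +-*-commutativeRing)
    using (sum; sum-syntax; sum-cong-≗; ∑-distrib-+; ∑-comm; *-distribˡ-sum; *-distribʳ-sum)
  open import Algebra.Properties.Semiring.Mult (CommutativeRing.semiring +-*-commutativeRing)
    using (×-homo-+; ×1-homo-*) renaming (_×_ to _·_)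

  ℚ-ring : AlmostCommutativeRing _ _
  ℚ-ring = fromCommutativeRing +-*-commutativeRing (λ x → dec⇒maybe (0ℚ ≟ x))

  p≤q⇒0≤q-p : ∀ {p q} → p ≤ q → 0ℚ ≤ q - p
  p≤q⇒0≤q-p {p} {q} p≤q = subst (_≤ q - p) (+-inverseʳ p) (+-monoˡ-≤ (- p) p≤q)

  -- The usual form of an inequality proof below: the difference is matched with a visibly
  -- nonnegative expression, and the ring solver checks the identity.
  ≤-fromDiff : ∀ {p q d} → 0ℚ ≤ d → q - p ≡ d → p ≤ q
  ≤-fromDiff {p} {q} {d} 0≤d eq =
    subst₂ _≤_ (+-identityˡ p) (trans (cong (_+ p) (sym eq)) (q-p+p q p)) (+-monoˡ-≤ p 0≤d)
    where
    q-p+p : ∀ q p → q - p + p ≡ q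
    q-p+p = solve-∀ ℚ-ring

  +-nonNeg : ∀ {p q} → 0ℚ ≤ p → 0ℚ ≤ q → 0ℚ ≤ p + q
  +-nonNeg 0≤p 0≤q = +-mono-≤ 0≤p 0≤q

  *-nonNeg : ∀ {p q} → 0ℚ ≤ p → 0ℚ ≤ q → 0ℚ ≤ p * q
  *-nonNeg {p} {q} 0≤p 0≤q = nonNegative⁻¹ (p * q)
    ⦃ nonNeg*nonNeg⇒nonNeg p ⦃ nonNegative 0≤p ⦄ q ⦃ nonNegative 0≤q ⦄ ⦄

  *-pos : ∀ {p q} → 0ℚ < p → 0ℚ < q → 0ℚ < p * q
  *-pos {p} {q} 0<p 0<q = positive⁻¹ (p * q)
    ⦃ pos*pos⇒pos p ⦃ positive 0<p ⦄ q ⦃ positive 0<q ⦄ ⦄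

  *-monoʳ-≤ : ∀ {p q} r → 0ℚ ≤ r → p ≤ q → r * p ≤ r * q
  *-monoʳ-≤ r 0≤r = *-monoˡ-≤-nonNeg r ⦃ nonNegative 0≤r ⦄

  *-mono-≤ : ∀ {p q r s} → 0ℚ ≤ p → 0ℚ ≤ s → p ≤ q → r ≤ s → p * r ≤ q * s
  *-mono-≤ {p} {q} {r} {s} 0≤p 0≤s p≤q r≤s = ≤-trans (*-monoʳ-≤ p 0≤p r≤s)
    (*-monoʳ-≤-nonNeg s ⦃ nonNegative 0≤s ⦄ p≤q)

  *-cancel-≤ : ∀ {p q} r → 0ℚ < r → r * p ≤ r * q → p ≤ q
  *-cancel-≤ r 0<r = *-cancelˡ-≤-pos r ⦃ positive 0<r ⦄

  square-nonNeg : ∀ p → 0ℚ ≤ p * p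
  square-nonNeg p with ≤-total 0ℚ p
  ... | inj₁ 0≤p = *-nonNeg 0≤p 0≤p
  ... | inj₂ p≤0 = subst (0ℚ ≤_) (-p*-p p) (*-nonNeg 0≤-p 0≤-p)
    where
    0≤-p = neg-antimono-≤ p≤0
    -p*-p : ∀ p → - p * - p ≡ p * p
    -p*-p = solve-∀ ℚ-ring

  square-pos : ∀ {p} → p ≢ 0ℚ → 0ℚ < p * p
  square-pos {p} p≢0 = ≤∧≢⇒< (square-nonNeg p) λ 0≡p² → p≢0 (p*p≡0⇒p≡0 (sym 0≡p²))
    where
    ≤∧≢⇒< : ∀ {p q} → p ≤ q → p ≢ q → p < q
    ≤∧≢⇒< {p} {q} p≤q p≢q with p <? q
    ... | yes p<q = p<q
    ... | no p≮q  = contradiction (≤-antisym p≤q (≮⇒≥ p≮q)) p≢q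
    cancel : ∀ r p → r * p * p ≡ r * (p * p)
    cancel = solve-∀ ℚ-ring
    p*p≡0⇒p≡0 : p * p ≡ 0ℚ → p ≡ 0ℚ
    p*p≡0⇒p≡0 p²≡0 = trans (sym (*-identityˡ p)) (trans (cong (_* p) (sym (*-inverseˡ p)))
      (trans (cancel (1/ p) p) (trans (cong (1/ p *_) p²≡0) (*-zeroʳ (1/ p)))))
      where instance _ = ≢-nonZero p≢0

  inverse : ∀ {p} → 0ℚ < p → ∃ λ q → 0ℚ < q × q * p ≡ 1ℚ
  inverse {p} 0<p = 1/ p , positive⁻¹ (1/ p) ⦃ 1/pos⇒pos p ⦄ , *-inverseˡ p
    where instance
      _ = positive 0<p
      _ = pos⇒nonZero p

  ·1-nonNeg : ∀ n → 0ℚ ≤ n · 1ℚ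
  ·1-nonNeg zero    = ≤-refl
  ·1-nonNeg (suc n) = +-nonNeg (nonNegative⁻¹ 1ℚ) (·1-nonNeg n)

  ·1-suc-pos : ∀ n → 0ℚ < suc n · 1ℚ
  ·1-suc-pos n = +-mono-<-≤ (positive⁻¹ 1ℚ) (·1-nonNeg n)

  ·1-mono-≤ : ∀ {m n} → m ℕ.≤ n → m · 1ℚ ≤ n · 1ℚ
  ·1-mono-≤ {n = n} ℕ.z≤n = ·1-nonNeg n
  ·1-mono-≤ (ℕ.s≤s m≤n)   = +-monoʳ-≤ 1ℚ (·1-mono-≤ m≤n)

  ·1-cancel-≤ : ∀ {m n} → m · 1ℚ ≤ n · 1ℚ → m ℕ.≤ n
  ·1-cancel-≤ {m} {n} m≤n with m ℕ.≤? n
  ... | yes le = le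
  ... | no m≰n with ℕ.m≤n⇒∃[o]m+o≡n (ℕ.≰⇒> m≰n)
  ...   | o , refl = contradiction (<-≤-trans n<m m≤n) (<-irrefl refl)
    where
    n<m : n · 1ℚ < (suc n ℕ.+ o) · 1ℚ
    n<m = subst₂ _<_ (+-identityʳ _) (sym (trans (×-homo-+ 1ℚ (suc n) o) (comm 1ℚ (n · 1ℚ) (o · 1ℚ))))
      (+-monoʳ-< (n · 1ℚ) (·1-suc-pos o))
      where
      comm : ∀ a b c → (a + b) + c ≡ b + (a + c)
      comm = solve-∀ ℚ-ring

  ·1-toℚᵘ : ∀ n → toℚᵘ (n · 1ℚ) ℚᵘ.≃ ℚᵘ.mkℚᵘ (ℤ.+ n) 0
  ·1-toℚᵘ zero    = ℚᵘ.≃-refl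
  ·1-toℚᵘ (suc n) = ℚᵘ.≃-trans (toℚᵘ-homo-+ 1ℚ (n · 1ℚ))
    (ℚᵘ.≃-trans (ℚᵘ.+-congʳ (ℚᵘ.mkℚᵘ (ℤ.+ 1) 0) (·1-toℚᵘ n)) (ℚᵘ.*≡*
      (cong (λ z → (ℤ.+ 1 ℤ.+ z) ℤ.* ℤ.+ 1) (ℤ.*-identityʳ (ℤ.+ n)))))

  -- Denominators are at least 1, so the absolute value of the numerator is a bound.
  ≤-natural : ∀ p → ∃ λ n → p ≤ n · 1ℚ
  ≤-natural p@(mkℚ z d _) = ℤ.∣ z ∣ , toℚᵘ-cancel-≤
    (ℚᵘ.≤-respʳ-≃ (ℚᵘ.≃-sym (·1-toℚᵘ ℤ.∣ z ∣)) (ℚᵘ.*≤* (bound z)))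
    where
    bound : ∀ z → z ℤ.* ℤ.+ 1 ℤ.≤ ℤ.+ ℤ.∣ z ∣ ℤ.* ℤ.+ suc d
    bound (ℤ.+ n)      = subst₂ ℤ._≤_ (sym (ℤ.*-identityʳ (ℤ.+ n))) (ℤ.pos-* n (suc d)) (ℤ.+≤+ (ℕ.m≤m*n n (suc d)))
    bound ℤ.-[1+ n ]   = ℤ.-≤+

  -- If e were positive, some n would bound b / e, while the hypothesis at n + 1 gives n + 1 ≤ b /
  -- e. Both limits of the proof, iterating T and letting t tend to 0, are taken through this lemma.
  archimedean : ∀ {e b} → (∀ n → n · 1ℚ * e ≤ b) → e ≤ 0ℚ
  archimedean {e} {b} bounded with e ≤? 0ℚ
  ... | yes e≤0 = e≤0
  ... | no e≰0 with inverse (≰⇒> e≰0)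
  ...   | e⁻¹ , 0<e⁻¹ , e⁻¹e≡1 with ≤-natural (e⁻¹ * b)
  ...     | n , e⁻¹b≤n = contradiction (·1-cancel-≤ {suc n} {n} (≤-trans 1+n≤e⁻¹b e⁻¹b≤n)) ℕ.1+n≰n
    where
    cancel : ∀ n e i → i * (n * e) ≡ n * (i * e)
    cancel = solve-∀ ℚ-ring
    1+n≤e⁻¹b : suc n · 1ℚ ≤ e⁻¹ * b
    1+n≤e⁻¹b = subst (_≤ e⁻¹ * b)
      (trans (cancel (suc n · 1ℚ) e e⁻¹) (trans (cong (suc n · 1ℚ *_) e⁻¹e≡1) (*-identityʳ _)))
      (*-monoʳ-≤ e⁻¹ (<⇒≤ 0<e⁻¹) (bounded (suc n)))

  ∑-mono : ∀ {n} {f g : Fin n → ℚ} → (∀ i → f i ≤ g i) → sum f ≤ sum g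
  ∑-mono {zero}  f≤g = ≤-refl
  ∑-mono {suc n} f≤g = +-mono-≤ (f≤g zero) (∑-mono (f≤g ∘ suc))

  ∑-zero : ∀ {n} {f : Fin n → ℚ} → (∀ i → f i ≡ 0ℚ) → sum f ≡ 0ℚ
  ∑-zero {zero}  f≡0 = refl
  ∑-zero {suc n} f≡0 = cong₂ _+_ (f≡0 zero) (∑-zero (f≡0 ∘ suc))

  ∑-nonNeg : ∀ {n} {f : Fin n → ℚ} → (∀ i → 0ℚ ≤ f i) → 0ℚ ≤ sum f
  ∑-nonNeg {zero}  0≤f = ≤-refl
  ∑-nonNeg {suc n} 0≤f = +-nonNeg (0≤f zero) (∑-nonNeg (0≤f ∘ suc))

  term≤∑ : ∀ {n} {f : Fin n → ℚ} → (∀ i → 0ℚ ≤ f i) → ∀ i → f i ≤ sum f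
  term≤∑ {suc n} {f} 0≤f zero    = subst (_≤ sum f) (+-identityʳ (f zero))
    (+-monoʳ-≤ (f zero) (∑-nonNeg (0≤f ∘ suc)))
  term≤∑ {suc n} {f} 0≤f (suc i) = subst (_≤ sum f) (+-identityˡ (f (suc i)))
    (+-mono-≤ (0≤f zero) (term≤∑ (0≤f ∘ suc) i))

  ∑-single : ∀ {n} {f : Fin n → ℚ} i → (∀ j → j ≢ i → f j ≡ 0ℚ) → sum f ≡ f i
  ∑-single {suc n} {f} zero f≡0 =
    trans (cong (f zero +_) (∑-zero (λ j → f≡0 (suc j) λ ()))) (+-identityʳ (f zero))
  ∑-single {suc n} {f} (suc i) f≡0 =
    trans (cong₂ _+_ (f≡0 zero λ ()) (∑-single i (λ j j≢i → f≡0 (suc j) (j≢i ∘ Fin.suc-injective))))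
      (+-identityˡ (f (suc i)))

  module _ {n : ℕ} where

    ∑-factorˡ : ∀ c (f : Fin n → ℚ) → ∑[ i < n ] (c * f i) ≡ c * sum f
    ∑-factorˡ c f = sym (*-distribˡ-sum c f)

    ∑-linear : ∀ a b (f g : Fin n → ℚ) →
               ∑[ i < n ] (a * f i + b * g i) ≡ a * sum f + b * sum g
    ∑-linear a b f g = trans (∑-distrib-+ (λ i → a * f i) (λ i → b * g i))
      (cong₂ _+_ (∑-factorˡ a f) (∑-factorˡ b g))

    ∑∑-product : ∀ (f g : Fin n → ℚ) → ∑[ i < n ] (∑[ j < n ] (f i * g j)) ≡ sum f * sum g
    ∑∑-product f g = trans (sum-cong-≗ (λ i → ∑-factorˡ (f i) g)) (sym (*-distribʳ-sum (sum g) f))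

  -- Variation, symmetric bilinear forms and the spectral argument.

  pairVariation : ∀ {n} → (Fin n → ℚ) → (Fin n → ℚ) → ℚ
  pairVariation {n} a y = ∑[ i < n ] (∑[ j < n ] (a i * a j * ((y i - y j) * (y i - y j))))

  -- Lagrange's identity: d is the defect in the Cauchy-Schwarz inequality for the weights a, and
  -- the double sum meets each pair of indices twice.
  pairVariation-expand : ∀ {n} (a y : Fin n → ℚ) →
    let d = sum a * ∑[ i < n ] (a i * (y i * y i)) - ∑[ i < n ] (a i * y i) * ∑[ i < n ] (a i * y i)
    in pairVariation a y ≡ d + d
  pairVariation-expand {n} a y = begin
    pairVariation a y
      ≡⟨ sum-cong-≗ (λ i → trans (sum-cong-≗ (λ j → split (a i) (a j) (y i) (y j)))
           (trans (∑-distrib-+ (λ j → a i * ay² j + ay² i * a j) (λ j → b i * ay j))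
             (cong (_+ sum (λ j → b i * ay j)) (∑-distrib-+ (λ j → a i * ay² j) (λ j → ay² i * a j))))) ⟩
    ∑[ i < n ] (∑[ j < n ] (a i * ay² j) + ∑[ j < n ] (ay² i * a j) + ∑[ j < n ] (b i * ay j))
      ≡⟨ ∑-distrib-+ (λ i → ∑[ j < n ] (a i * ay² j) + ∑[ j < n ] (ay² i * a j)) _ ⟩
    ∑[ i < n ] (∑[ j < n ] (a i * ay² j) + ∑[ j < n ] (ay² i * a j)) + ∑[ i < n ] (∑[ j < n ] (b i * ay j))
      ≡⟨ cong₂ _+_ (trans (∑-distrib-+ (λ i → ∑[ j < n ] (a i * ay² j)) _)
           (cong₂ _+_ (∑∑-product a ay²) (∑∑-product ay² a)))
           (trans (∑∑-product b ay) (cong (_* sum ay) (∑-factorˡ (- (1ℚ + 1ℚ)) ay))) ⟩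
    sum a * sum ay² + sum ay² * sum a + (- (1ℚ + 1ℚ)) * sum ay * sum ay
      ≡⟨ collect (sum a) (sum ay) (sum ay²) ⟩
    _ ∎
    where
    open ≡-Reasoning
    ay ay² b : Fin n → ℚ
    ay i  = a i * y i
    ay² i = a i * (y i * y i)
    b i   = (- (1ℚ + 1ℚ)) * ay i
    split : ∀ a b x y → a * b * ((x - y) * (x - y)) ≡
            a * (b * (y * y)) + a * (x * x) * b + (- (1ℚ + 1ℚ)) * (a * x) * (b * y)
    split = solve-∀ ℚ-ring
    collect : ∀ s₀ s₁ s₂ → s₀ * s₂ + s₂ * s₀ + (- (1ℚ + 1ℚ)) * s₁ * s₁ ≡ (s₀ * s₂ - s₁ * s₁) + (s₀ * s₂ - s₁ * s₁)
    collect = solve-∀ ℚ-ring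

  -- The pair form is a sum of squares with coefficients `a i * a j`, so it grows with the weights;
  -- the difference d does not show this.
  pairVariation-mono : ∀ {n} {a b : Fin n → ℚ} y → (∀ i → 0ℚ ≤ a i) → (∀ i → a i ≤ b i) →
                       pairVariation a y ≤ pairVariation b y
  pairVariation-mono {a = a} {b} y 0≤a a≤b = ∑-mono λ i → ∑-mono λ j →
    *-monoʳ-≤-nonNeg ((y i - y j) * (y i - y j)) ⦃ nonNegative (square-nonNeg (y i - y j)) ⦄
      (*-mono-≤ (0≤a i) (≤-trans (0≤a j) (a≤b j)) (a≤b i) (a≤b j))

  pairVariation-nonNeg : ∀ {n} {a : Fin n → ℚ} y → (∀ i → 0ℚ ≤ a i) → 0ℚ ≤ pairVariation a y
  pairVariation-nonNeg y 0≤a = ∑-nonNeg λ i → ∑-nonNeg λ j →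
    *-nonNeg (*-nonNeg (0≤a i) (0≤a j)) (square-nonNeg (y i - y j))

  module BilinearForm {n : ℕ} (A : Fin n → Fin n → ℚ) where

    infixr 8 A∙_
    A∙_ : (Fin n → ℚ) → (Fin n → ℚ)
    (A∙ v) i = ∑[ j < n ] (A i j * v j)

    B : (Fin n → ℚ) → (Fin n → ℚ) → ℚ
    B u v = ∑[ i < n ] (u i * (A∙ v) i)

    B-linearˡ : ∀ a b u v w → B (λ i → a * u i + b * v i) w ≡ a * B u w + b * B v w
    B-linearˡ a b u v w = trans (sum-cong-≗ (λ i → expand a b (u i) (v i) ((A∙ w) i)))
      (∑-linear a b (λ i → u i * (A∙ w) i) (λ i → v i * (A∙ w) i))
      where
      expand : ∀ a b u v w → (a * u + b * v) * w ≡ a * (u * w) + b * (v * w)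
      expand = solve-∀ ℚ-ring

    B-+ˡ : ∀ u v w → B (λ i → u i + v i) w ≡ B u w + B v w
    B-+ˡ u v w = trans (sum-cong-≗ (λ i → *-distribʳ-+ ((A∙ w) i) (u i) (v i)))
      (∑-distrib-+ (λ i → u i * (A∙ w) i) (λ i → v i * (A∙ w) i))

    module _ (A-sym : ∀ i j → A i j ≡ A j i) where

      B-sym : ∀ u v → B u v ≡ B v u
      B-sym u v = begin
        ∑[ i < n ] (u i * (A∙ v) i)
          ≡⟨ sum-cong-≗ (λ i → *-distribˡ-sum (u i) (λ j → A i j * v j)) ⟩
        ∑[ i < n ] (∑[ j < n ] (u i * (A i j * v j)))
          ≡⟨ ∑-comm (λ i j → u i * (A i j * v j)) ⟩
        ∑[ j < n ] (∑[ i < n ] (u i * (A i j * v j)))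
          ≡⟨ sum-cong-≗ (λ j → trans (sum-cong-≗ (λ i → swap (u i) (v j) (A-sym i j)))
               (sym (*-distribˡ-sum (v j) (λ i → A j i * u i)))) ⟩
        ∑[ j < n ] (v j * (A∙ u) j) ∎
        where
        open ≡-Reasoning
        rearr : ∀ u v a → u * (a * v) ≡ v * (a * u)
        rearr = solve-∀ ℚ-ring
        swap : ∀ u v {a b} → a ≡ b → u * (a * v) ≡ v * (b * u)
        swap u v {a} refl = rearr u v a

      B-linearʳ : ∀ a b u v w → B w (λ i → a * u i + b * v i) ≡ a * B w u + b * B w v
      B-linearʳ a b u v w = trans (B-sym w _) (trans (B-linearˡ a b u v w)
        (cong₂ (λ x y → a * x + b * y) (B-sym u w) (B-sym v w)))

      B-+ʳ : ∀ u v w → B w (λ i → u i + v i) ≡ B w u + B w v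
      B-+ʳ u v w = trans (B-sym w _) (trans (B-+ˡ u v w) (cong₂ _+_ (B-sym u w) (B-sym v w)))

      -- Test the form on ℓ(v) u − ℓ(u) v, which lies on the hyperplane ℓ = 0.
      reversedCauchySchwarz : (ℓ : (Fin n → ℚ) → ℚ) →
        (∀ a b u v → ℓ (λ i → a * u i + b * v i) ≡ a * ℓ u + b * ℓ v) →
        (∀ x → ℓ x ≡ 0ℚ → B x x ≤ 0ℚ) →
        ∀ u v → ℓ v ≢ 0ℚ → 0ℚ ≤ B v v → B u u * B v v ≤ B u v * B u v
      reversedCauchySchwarz ℓ ℓ-linear nonPos u v ℓv≢0 0≤Bvv = *-cancel-≤ (p * p) (square-pos ℓv≢0)
        (≤-fromDiff (+-nonNeg (square-nonNeg (q * B v v + (- (p * B u v))))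
            (*-nonNeg 0≤Bvv (neg-antimono-≤ (nonPos x ℓx≡0))))
          (trans (identity p q (B u u) (B u v) (B v v))
            (cong (λ z → (q * B v v + (- (p * B u v))) * (q * B v v + (- (p * B u v))) + B v v * (- z)) (sym Bxx))))
        where
        p = ℓ v
        q = ℓ u
        x : Fin n → ℚ
        x i = p * u i + (- q) * v i
        ℓx≡0 : ℓ x ≡ 0ℚ
        ℓx≡0 = trans (ℓ-linear p (- q) u v) (cancel p q)
          where
          cancel : ∀ p q → p * q + (- q) * p ≡ 0ℚ
          cancel = solve-∀ ℚ-ring
        Bxx : B x x ≡ p * (p * B u u + (- q) * B u v) + (- q) * (p * B u v + (- q) * B v v)
        Bxx = trans (B-linearˡ p (- q) u v x) (cong₂ (λ s t → p * s + (- q) * t)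
          (B-linearʳ p (- q) u v u)
          (trans (B-linearʳ p (- q) u v v) (cong (λ z → p * z + (- q) * B v v) (B-sym v u))))
        -- Here a, b, c are `B u u`, `B u v`, `B v v`. The claimed difference times p² is a square
        -- minus c times the value of the form at x.
        identity : ∀ p q a b c → p * p * (b * b) - p * p * (a * c) ≡
          (q * c + (- (p * b))) * (q * c + (- (p * b))) +
          c * (- (p * (p * a + (- q) * b) + (- q) * (p * b + (- q) * c)))
        identity = solve-∀ ℚ-ring

  B-∑ : ∀ {m n} {A : Fin n → Fin n → ℚ} (w : Fin m → ℚ) (A′ : Fin m → Fin n → Fin n → ℚ) →
        (∀ i j → A i j ≡ ∑[ a < m ] (w a * A′ a i j)) →
        ∀ u v → BilinearForm.B A u v ≡ ∑[ a < m ] (w a * BilinearForm.B (A′ a) u v)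
  B-∑ {m} {n} {A} w A′ A≡∑ u v = begin
    ∑[ i < n ] (u i * ∑[ j < n ] (A i j * v j))
      ≡⟨ sum-cong-≗ (λ i → trans (*-distribˡ-sum (u i) (λ j → A i j * v j))
           (trans (sum-cong-≗ (λ j → trans (cong (λ z → u i * (z * v j)) (A≡∑ i j)) (pull i j)))
             (∑-comm (λ j a → w a * (u i * (A′ a i j * v j)))))) ⟩
    ∑[ i < n ] (∑[ a < m ] (∑[ j < n ] (w a * (u i * (A′ a i j * v j)))))
      ≡⟨ ∑-comm (λ i a → ∑[ j < n ] (w a * (u i * (A′ a i j * v j)))) ⟩
    ∑[ a < m ] (∑[ i < n ] (∑[ j < n ] (w a * (u i * (A′ a i j * v j)))))
      ≡⟨ sum-cong-≗ (λ a → trans (sum-cong-≗ (λ i → trans (∑-factorˡ (w a) (λ j → u i * (A′ a i j * v j)))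
           (cong (w a *_) (∑-factorˡ (u i) (λ j → A′ a i j * v j)))))
           (∑-factorˡ (w a) (λ i → u i * ∑[ j < n ] (A′ a i j * v j)))) ⟩
    ∑[ a < m ] (w a * ∑[ i < n ] (u i * ∑[ j < n ] (A′ a i j * v j))) ∎
    where
    open ≡-Reasoning
    rearr : ∀ u v w a → u * (w * a * v) ≡ w * (u * (a * v))
    rearr = solve-∀ ℚ-ring
    pull : ∀ i j → u i * (∑[ a < m ] (w a * A′ a i j) * v j) ≡ ∑[ a < m ] (w a * (u i * (A′ a i j * v j)))
    pull i j = trans (cong (u i *_) (*-distribʳ-sum (v j) (λ a → w a * A′ a i j)))
      (trans (*-distribˡ-sum (u i) (λ a → w a * A′ a i j * v j))
        (sum-cong-≗ (λ a → rearr (u i) (v j) (w a) (A′ a i j))))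

  -- T = DA is a Markov operator reversible for the row sums of A.  The hypothesis
  -- B u u ≤ B (T u) u says that its spectrum avoids (0, 1), and the positive column o
  -- makes the eigenvalue 1 simple, so the spectrum on the complement of the constants
  -- is nonpositive.  Eigenvalues are replaced by the potential
  -- Φ u = B (T u) u + B u u: it is nondecreasing along the iterates of T, since
  -- λ(1 + λ)(λ² − 1) = λ(λ − 1)(1 + λ)², whereas B (T u) u decays geometrically.
  module SpectralGap {n : ℕ} (A : Fin n → Fin n → ℚ) (D : Fin n → ℚ) (o : Fin n) (δ : ℚ) where
    open BilinearForm A

    r : Fin n → ℚ
    r i = ∑[ j < n ] (A i j)

    T : (Fin n → ℚ) → (Fin n → ℚ)
    T u i = D i * (A∙ u) i

    module _
      (A-sym : ∀ i j → A i j ≡ A j i)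
      (0≤A : ∀ i j → 0ℚ ≤ A i j)
      (0≤D : ∀ i → 0ℚ ≤ D i)
      -- D inverts the row sum of every nonzero row; stated in this form, rows that vanish are
      -- allowed.
      (DrA : ∀ i j → D i * r i * A i j ≡ A i j)
      (0<Do : 0ℚ < D o)
      (0<ro : 0ℚ < r o)
      (0<δ : 0ℚ < δ)
      -- A minorisation in the style of Doeblin: one step from o reaches each j with weight at least
      -- proportional to the invariant measure r.
      (column : ∀ j → δ * r j ≤ A o j)
      (gap : ∀ u → B u u ≤ B (T u) u)
      where

      private
        0≤r : ∀ i → 0ℚ ≤ r i
        0≤r i = ∑-nonNeg (0≤A i)

        N Φ : (Fin n → ℚ) → ℚ
        N u = B (T u) u
        Φ u = N u + B u u

        R ε : ℚ
        R = sum r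
        ε = D o * (δ * δ * R)

        0<R : 0ℚ < R
        0<R = <-≤-trans 0<ro (term≤∑ 0≤r o)

        0<ε : 0ℚ < ε
        0<ε = *-pos 0<Do (*-pos (*-pos 0<δ 0<δ) 0<R)

        DrAu : ∀ u i → D i * r i * (A∙ u) i ≡ (A∙ u) i
        DrAu u i = trans (*-distribˡ-sum (D i * r i) (λ j → A i j * u j))
          (sum-cong-≗ (λ j → trans (sym (*-assoc (D i * r i) (A i j) (u j))) (cong (_* u j) (DrA i j))))

        Au≡rTu : ∀ u i → (A∙ u) i ≡ r i * T u i
        Au≡rTu u i = trans (sym (DrAu u i)) (rearr (D i) (r i) ((A∙ u) i))
          where
          rearr : ∀ d r a → d * r * a ≡ r * (d * a)
          rearr = solve-∀ ℚ-ring

        N-nonNeg : ∀ u → 0ℚ ≤ N u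
        N-nonNeg u = ∑-nonNeg λ i → subst (0ℚ ≤_) (sym (*-assoc (D i) _ _))
          (*-nonNeg (0≤D i) (square-nonNeg ((A∙ u) i)))

        T-adjoint : ∀ u v → B (T u) v ≡ B (T v) u
        T-adjoint u v = sum-cong-≗ (λ i → rearr (D i) ((A∙ u) i) ((A∙ v) i))
          where
          rearr : ∀ d a b → d * a * b ≡ d * b * a
          rearr = solve-∀ ℚ-ring

        ∑Au : ∀ u → ∑[ i < n ] ((A∙ u) i) ≡ ∑[ j < n ] (r j * u j)
        ∑Au u = trans (∑-comm (λ i j → A i j * u j)) (sum-cong-≗ (λ j →
          trans (sym (*-distribʳ-sum (u j) (λ i → A i j))) (cong (_* u j) (sum-cong-≗ (λ i → A-sym i j)))))

        -- Symmetry of A makes r invariant, so the iterates of T stay in the mean-zero hyperplane.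
        mean-T : ∀ u → ∑[ i < n ] (r i * T u i) ≡ ∑[ i < n ] (r i * u i)
        mean-T u = trans (sum-cong-≗ (λ i → sym (Au≡rTu u i))) (∑Au u)

        module _ (u : Fin n → ℚ) (mean0 : ∑[ i < n ] (r i * u i) ≡ 0ℚ) where
          y : Fin n → ℚ
          y = T u

          energy : Fin n → ℚ
          energy i = ∑[ j < n ] (A i j * (y j * y j))

          N≡∑ry² : N u ≡ ∑[ i < n ] (r i * (y i * y i))
          N≡∑ry² = sum-cong-≗ (λ i → trans (cong (y i *_) (Au≡rTu u i)) (rearr (y i) (r i)))
            where
            rearr : ∀ y r → y * (r * y) ≡ r * (y * y)
            rearr = solve-∀ ℚ-ring

          N≡∑energy : N u ≡ sum energy
          N≡∑energy = trans N≡∑ry² (sym (∑Au (λ i → y i * y i)))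

          -- The law of total variance. `N u` is the squared r-norm of y = T u, and what it loses
          -- under a further T is the variance of y over one step of the chain, collected row by
          -- row.
          dissipation : (N u - N y) + (N u - N y) ≡ ∑[ i < n ] (D i * pairVariation (A i) y)
          dissipation = sym (begin
            ∑[ i < n ] (D i * pairVariation (A i) y)
              ≡⟨ sum-cong-≗ (λ i → trans (cong (D i *_) (pairVariation-expand (A i) y))
                   (trans (rearr (D i) (r i) (energy i) ((A∙ y) i))
                     (cong (λ z → (1ℚ + 1ℚ) * z + (- (1ℚ + 1ℚ)) * (T y i * (A∙ y) i)) (DrAu (λ j → y j * y j) i)))) ⟩
            ∑[ i < n ] ((1ℚ + 1ℚ) * energy i + (- (1ℚ + 1ℚ)) * (T y i * (A∙ y) i))
              ≡⟨ ∑-linear (1ℚ + 1ℚ) (- (1ℚ + 1ℚ)) energy (λ i → T y i * (A∙ y) i) ⟩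
            (1ℚ + 1ℚ) * sum energy + (- (1ℚ + 1ℚ)) * N y
              ≡⟨ cong (λ z → (1ℚ + 1ℚ) * z + (- (1ℚ + 1ℚ)) * N y) (sym N≡∑energy) ⟩
            (1ℚ + 1ℚ) * N u + (- (1ℚ + 1ℚ)) * N y
              ≡⟨ double (N u) (N y) ⟩
            (N u - N y) + (N u - N y) ∎)
            where
            open ≡-Reasoning
            rearr : ∀ d r e a → d * ((r * e - a * a) + (r * e - a * a)) ≡
                    (1ℚ + 1ℚ) * (d * r * e) + (- (1ℚ + 1ℚ)) * (d * a * a)
            rearr = solve-∀ ℚ-ring
            double : ∀ a b → (1ℚ + 1ℚ) * a + (- (1ℚ + 1ℚ)) * b ≡ (a - b) + (a - b)
            double = solve-∀ ℚ-ring

          variance : pairVariation (λ j → δ * r j) y ≡ δ * δ * R * N u + δ * δ * R * N u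
          variance = trans (pairVariation-expand (λ j → δ * r j) y)
            (trans (cong₂ (λ s t → (s - t) + (s - t))
                (cong₂ _*_ (∑-factorˡ δ r)
                  (trans (sum-cong-≗ (λ i → *-assoc δ (r i) (y i * y i)))
                    (trans (∑-factorˡ δ (λ i → r i * (y i * y i))) (cong (δ *_) (sym N≡∑ry²)))))
                (cong₂ _*_ mean mean))
              (rearr δ R (N u)))
            where
            mean : ∑[ i < n ] (δ * r i * y i) ≡ δ * 0ℚ
            mean = trans (sum-cong-≗ (λ i → *-assoc δ (r i) (y i)))
              (trans (∑-factorˡ δ (λ i → r i * y i)) (cong (δ *_) (trans (mean-T u) mean0)))
            rearr : ∀ δ R N → (δ * R * (δ * N) - δ * 0ℚ * (δ * 0ℚ)) + (δ * R * (δ * N) - δ * 0ℚ * (δ * 0ℚ))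
                    ≡ δ * δ * R * N + δ * δ * R * N
            rearr = solve-∀ ℚ-ring

          -- Only the row o of the dissipation is kept. Its weights dominate `δ * r`, and for these
          -- the variation of y is a fixed multiple of `N u`, because y has mean zero. So T removes
          -- at least the fraction ε of N.
          decay : N y + N y ≤ (N u - ε * N u) + (N u - ε * N u)
          decay = ≤-fromDiff (p≤q⇒0≤q-p bound) (rearr (N u) (N y) (D o) (δ * δ * R))
            where
            bound : D o * (δ * δ * R * N u + δ * δ * R * N u) ≤ (N u - N y) + (N u - N y)
            bound = ≤-trans (*-monoʳ-≤ (D o) (<⇒≤ 0<Do)
                (subst (_≤ pairVariation (A o) y) variance
                  (pairVariation-mono y (λ j → *-nonNeg (<⇒≤ 0<δ) (0≤r j)) column)))
              (subst (D o * pairVariation (A o) y ≤_) (sym dissipation)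
                (term≤∑ (λ i → *-nonNeg (0≤D i) (pairVariation-nonNeg y (0≤A i))) o))
            rearr : ∀ a b d e → ((a - d * e * a) + (a - d * e * a)) - (b + b) ≡
                    ((a - b) + (a - b)) - d * (e * a + e * a)
            rearr = solve-∀ ℚ-ring

        -- This is `gap` at u + T u. With a_k = B (T^k u) u it reads a_0 + 2 a_1 + a_2 ≤ a_1 + 2 a_2
        -- + a_3, that is, a_0 + a_1 ≤ a_2 + a_3.
        Φ-mono : ∀ u → Φ u ≤ Φ (T u)
        Φ-mono u = ≤-fromDiff (p≤q⇒0≤q-p (gap s)) (trans (rearr (B u u) (N u) (B (T u) (T u)) (N (T u)))
            (cong₂ _-_ (sym Ns) (sym Bss)))
          where
          s : Fin n → ℚ
          s i = u i + T u i
          rearr : ∀ a₀ a₁ a₂ a₃ → (a₃ + a₂) - (a₁ + a₀) ≡ ((a₁ + a₂) + (a₂ + a₃)) - ((a₀ + a₁) + (a₁ + a₂))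
          rearr = solve-∀ ℚ-ring
          Ns : N s ≡ (N u + B (T u) (T u)) + (B (T u) (T u) + N (T u))
          Ns = trans (B-+ʳ A-sym u (T u) (T s)) (cong₂ _+_
            (trans (T-adjoint s u) (B-+ʳ A-sym u (T u) (T u)))
            (trans (T-adjoint s (T u)) (trans (B-+ʳ A-sym u (T u) (T (T u)))
              (cong (_+ N (T u)) (T-adjoint (T u) u)))))
          Bss : B s s ≡ (B u u + N u) + (N u + B (T u) (T u))
          Bss = trans (B-+ˡ u (T u) s) (cong₂ _+_
            (trans (B-+ʳ A-sym u (T u) u) (cong (B u u +_) (B-sym A-sym u (T u))))
            (B-+ʳ A-sym u (T u) (T u)))

        -- By `decay`, passing from u to T u releases at least 2 ε `N u`, which is at least ε `Φ u`
        -- by `gap`. As Φ does not decrease along the way, k steps release at least k ε `Φ u`.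
        iterate : ∀ k u → ∑[ i < n ] (r i * u i) ≡ 0ℚ → k · 1ℚ * (ε * Φ u) ≤ N u + N u
        iterate zero    u mean0 = subst (_≤ N u + N u) (sym (*-zeroˡ (ε * Φ u)))
          (+-nonNeg (N-nonNeg u) (N-nonNeg u))
        iterate (suc k) u mean0 = ≤-fromDiff
          (+-nonNeg (p≤q⇒0≤q-p (≤-trans (iterate k (T u) (trans (mean-T u) mean0)) (decay u mean0)))
            (+-nonNeg (*-nonNeg (*-nonNeg (·1-nonNeg k) (<⇒≤ 0<ε)) (p≤q⇒0≤q-p (Φ-mono u)))
              (*-nonNeg (<⇒≤ 0<ε) (p≤q⇒0≤q-p (gap u)))))
          (rearr (k · 1ℚ) ε (N u) (B u u) (Φ (T u)))
          where
          rearr : ∀ k ε a b c → (a + a) - (1ℚ + k) * (ε * (a + b)) ≡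
            (((a - ε * a) + (a - ε * a)) - k * (ε * c)) + (k * ε * (c - (a + b)) + ε * (a - b))
          rearr = solve-∀ ℚ-ring

      -- A bound on k ε `Φ u` uniform in k forces Φ u ≤ 0, and `B u u` is at most `Φ u` since N is
      -- nonnegative.
      nonPositive-on-mean-zero : ∀ u → ∑[ i < n ] (r i * u i) ≡ 0ℚ → B u u ≤ 0ℚ
      nonPositive-on-mean-zero u mean0 = ≤-trans
        (subst (_≤ Φ u) (+-identityˡ (B u u)) (+-monoˡ-≤ (B u u) (N-nonNeg u)))
        (*-cancel-≤ ε 0<ε (subst (ε * Φ u ≤_) (sym (*-zeroʳ ε)) (archimedean (λ k → iterate k u mean0))))

  -- Weighted walks, their Hessians and log-concavity.

  module WeightedWalks {x} {X : Set x} {n : ℕ} (extend : X → Fin n → X) (α : X → Fin n → ℚ) where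

    infixl 8 _⊕_
    _⊕_ : X → Fin n → X
    _⊕_ = extend

    -- With F_k(u₁, …, u_k) the symmetric multilinear form that sums the weights of the
    -- walks S, S ⊕ a₁, S ⊕ a₁ ⊕ a₂, … of length k times u₁(a₁) ⋯ u_k(a_k), these are
    -- G k = F_k(1, …, 1), L k u = F_{k+1}(u, 1, …, 1) and Q k u v = F_{k+2}(u, v, 1, …, 1).
    G : ℕ → X → ℚ
    G zero    S = 1ℚ
    G (suc k) S = ∑[ a < n ] (α S a * G k (S ⊕ a))

    hessian : ℕ → X → Fin n → Fin n → ℚ
    hessian k S a b = α S a * α (S ⊕ a) b * G k (S ⊕ a ⊕ b)

    Q : ℕ → X → (Fin n → ℚ) → (Fin n → ℚ) → ℚ
    Q k S = BilinearForm.B (hessian k S)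

    L : ℕ → X → (Fin n → ℚ) → ℚ
    L k S u = ∑[ a < n ] (α S a * G k (S ⊕ a) * u a)

    ones : Fin n → ℚ
    ones _ = 1ℚ

    hessian∙ : ∀ k S u a → BilinearForm.A∙_ (hessian k S) u a ≡ α S a * L k (S ⊕ a) u
    hessian∙ k S u a = trans (sum-cong-≗ (λ b → rearr (α S a) (α (S ⊕ a) b) (G k (S ⊕ a ⊕ b)) (u b)))
      (∑-factorˡ (α S a) (λ b → α (S ⊕ a) b * G k (S ⊕ a ⊕ b) * u b))
      where
      rearr : ∀ a b g u → a * b * g * u ≡ a * (b * g * u)
      rearr = solve-∀ ℚ-ring

    L-ones : ∀ k S → L k S ones ≡ G (suc k) S
    L-ones k S = sum-cong-≗ (λ a → *-identityʳ (α S a * G k (S ⊕ a)))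

    hessian-rowSum : ∀ k S a → ∑[ b < n ] (hessian k S a b) ≡ α S a * G (suc k) (S ⊕ a)
    hessian-rowSum k S a = trans (sum-cong-≗ (λ b → *-assoc (α S a) (α (S ⊕ a) b) (G k (S ⊕ a ⊕ b))))
      (∑-factorˡ (α S a) (λ b → α (S ⊕ a) b * G k (S ⊕ a ⊕ b)))

    Q-ones : ∀ k S u → Q k S u ones ≡ L (suc k) S u
    Q-ones k S u = sum-cong-≗ (λ a → trans (cong (u a *_) (trans (hessian∙ k S ones a)
      (cong (α S a *_) (L-ones k (S ⊕ a))))) (*-comm (u a) (α S a * G (suc k) (S ⊕ a))))

    Q-ones-ones : ∀ k S → Q k S ones ones ≡ G (suc (suc k)) S
    Q-ones-ones k S = trans (Q-ones k S ones) (L-ones (suc k) S)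

    module LogConcavity
      (⊕-comm : ∀ S a b → S ⊕ a ⊕ b ≡ S ⊕ b ⊕ a)
      (α-comm : ∀ S a b → α S a * α (S ⊕ a) b ≡ α S b * α (S ⊕ b) a)
      (0≤α : ∀ S a → 0ℚ ≤ α S a)
      (α≤1 : ∀ S a → α S a ≤ 1ℚ)
      (β : Fin n → ℚ) (0≤β : ∀ a → 0ℚ ≤ β a)
      -- Thus `α S a` is either 0 or the inverse of `β a`, with β independent of S.
      (βα² : ∀ S a → β a * α S a * α S a ≡ α S a)
      (o : Fin n) (0<βo : 0ℚ < β o)
      (⊕-o : ∀ S → S ⊕ o ≡ S)
      (t : ℚ) (0<t : 0ℚ < t) (α-o : ∀ S → α S o ≡ t)
      (base : ∀ S u → ∑[ a < n ] (α S a * u a) ≡ 0ℚ → Q 0 S u u ≤ 0ℚ)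
      where

      -- Staying at o contributes t at each step, so t^k is a lower bound uniform in S. Uniform
      -- bounds are what yields the constant δ of the spectral argument.
      G-lower : ∀ k → ∃ λ l → 0ℚ < l × (∀ S → l ≤ G k S)
      G-lower zero    = 1ℚ , positive⁻¹ 1ℚ , λ S → ≤-refl
      G-lower (suc k) with G-lower k
      ... | l , 0<l , l≤G = t * l , *-pos 0<t 0<l , λ S → ≤-trans
        (*-mono-≤ (<⇒≤ 0<t) (≤-trans (<⇒≤ 0<l) (l≤G (S ⊕ o))) (≤-reflexive (sym (α-o S))) (l≤G (S ⊕ o)))
        (term≤∑ (λ a → *-nonNeg (0≤α S a) (≤-trans (<⇒≤ 0<l) (l≤G (S ⊕ a)))) o)

      G-pos : ∀ k S → 0ℚ < G k S
      G-pos k S with G-lower k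
      ... | l , 0<l , l≤G = <-≤-trans 0<l (l≤G S)

      G-upper : ∀ k → ∃ λ h → 0ℚ < h × (∀ S → G k S ≤ h)
      G-upper zero    = 1ℚ , positive⁻¹ 1ℚ , λ S → ≤-refl
      G-upper (suc k) with G-upper k
      ... | h , 0<h , G≤h = ∑[ a < n ] h , <-≤-trans 0<h (term≤∑ {f = λ _ → h} (λ a → <⇒≤ 0<h) o) ,
        λ S → ∑-mono λ a → subst (α S a * G k (S ⊕ a) ≤_) (*-identityˡ h)
          (*-mono-≤ (0≤α S a) (<⇒≤ 0<h) (α≤1 S a) (G≤h (S ⊕ a)))

      hessian-sym : ∀ k S a b → hessian k S a b ≡ hessian k S b a
      hessian-sym k S a b = cong₂ _*_ (α-comm S a b) (cong (G k) (⊕-comm S a b))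

      0≤hessian : ∀ k S a b → 0ℚ ≤ hessian k S a b
      0≤hessian k S a b = *-nonNeg (*-nonNeg (0≤α S a) (0≤α (S ⊕ a) b)) (<⇒≤ (G-pos k (S ⊕ a ⊕ b)))

      -- The third step of the walk is moved past c and then past b to the front, by commutativity
      -- of steps and of weights. The Hessian at S thus becomes a weighted sum of shorter Hessians.
      hessian-suc : ∀ k S b c → hessian (suc k) S b c ≡ ∑[ a < n ] (α S a * hessian k (S ⊕ a) b c)
      hessian-suc k S b c = trans (*-distribˡ-sum (α S b * α (S ⊕ b) c) (λ a → α (S ⊕ b ⊕ c) a * G k (S ⊕ b ⊕ c ⊕ a))) (sum-cong-≗ step)
        where
        rearr₁ : ∀ p q r g → p * q * (r * g) ≡ p * (q * r) * g
        rearr₁ = solve-∀ ℚ-ring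
        rearr₂ : ∀ p q r g → p * (q * r) * g ≡ p * q * r * g
        rearr₂ = solve-∀ ℚ-ring
        rearr₃ : ∀ p q r g → p * q * r * g ≡ p * (q * r * g)
        rearr₃ = solve-∀ ℚ-ring
        step : ∀ a → α S b * α (S ⊕ b) c * (α (S ⊕ b ⊕ c) a * G k (S ⊕ b ⊕ c ⊕ a)) ≡
                     α S a * hessian k (S ⊕ a) b c
        step a = begin
          α S b * α (S ⊕ b) c * (α (S ⊕ b ⊕ c) a * G k (S ⊕ b ⊕ c ⊕ a))
            ≡⟨ rearr₁ (α S b) _ _ _ ⟩
          α S b * (α (S ⊕ b) c * α (S ⊕ b ⊕ c) a) * G k (S ⊕ b ⊕ c ⊕ a)
            ≡⟨ cong₂ (λ w s → α S b * w * G k s) (α-comm (S ⊕ b) c a) (⊕-comm (S ⊕ b) c a) ⟩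
          α S b * (α (S ⊕ b) a * α (S ⊕ b ⊕ a) c) * G k (S ⊕ b ⊕ a ⊕ c)
            ≡⟨ rearr₂ (α S b) _ _ _ ⟩
          α S b * α (S ⊕ b) a * α (S ⊕ b ⊕ a) c * G k (S ⊕ b ⊕ a ⊕ c)
            ≡⟨ cong₂ (λ w s → w * α s c * G k (s ⊕ c)) (α-comm S b a) (⊕-comm S b a) ⟩
          α S a * α (S ⊕ a) b * α (S ⊕ a ⊕ b) c * G k (S ⊕ a ⊕ b ⊕ c)
            ≡⟨ rearr₃ (α S a) _ _ _ ⟩
          α S a * hessian k (S ⊕ a) b c ∎
          where open ≡-Reasoning

      -- The all-ones vector is the positive direction of the reversed Cauchy-Schwarz inequality.
      -- The hyperplane is left free, since the base case and the induction step use different ones.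
      hyperbolic-at-ones : ∀ k S → (ℓ : (Fin n → ℚ) → ℚ) →
        (∀ a b u v → ℓ (λ i → a * u i + b * v i) ≡ a * ℓ u + b * ℓ v) →
        0ℚ < ℓ ones → (∀ u → ℓ u ≡ 0ℚ → Q k S u u ≤ 0ℚ) →
        ∀ u → Q k S u u * G (suc (suc k)) S ≤ L (suc k) S u * L (suc k) S u
      hyperbolic-at-ones k S ℓ ℓ-linear 0<ℓ1 nonPos u =
        subst₂ _≤_ (cong (Q k S u u *_) (Q-ones-ones k S)) (cong₂ _*_ (Q-ones k S u) (Q-ones k S u))
          (BilinearForm.reversedCauchySchwarz (hessian k S) (hessian-sym k S) ℓ ℓ-linear nonPos u ones
            (λ ℓ1≡0 → <-irrefl (sym ℓ1≡0) 0<ℓ1)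
            (subst (0ℚ ≤_) (sym (Q-ones-ones k S)) (<⇒≤ (G-pos (suc (suc k)) S))))

      weighted-linear : ∀ (w : Fin n → ℚ) a b (u v : Fin n → ℚ) →
        ∑[ i < n ] (w i * (a * u i + b * v i)) ≡ a * ∑[ i < n ] (w i * u i) + b * ∑[ i < n ] (w i * v i)
      weighted-linear w a b u v = trans (sum-cong-≗ (λ i → expand (w i) a b (u i) (v i)))
        (∑-linear a b (λ i → w i * u i) (λ i → w i * v i))
        where
        expand : ∀ w a b u v → w * (a * u + b * v) ≡ a * (w * u) + b * (w * v)
        expand = solve-∀ ℚ-ring

      -- Induction on k: the inequalities at all `S ⊕ a`, weighted and summed, supply the hypothesis
      -- `gap` of the spectral argument at S.
      hyperbolic : ∀ k S u → Q k S u u * G (suc (suc k)) S ≤ L (suc k) S u * L (suc k) S u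
      hyperbolic zero S = hyperbolic-at-ones zero S (λ u → ∑[ a < n ] (α S a * u a))
        (weighted-linear (α S)) (G-pos 1 S) (base S)
      hyperbolic (suc k) S = hyperbolic-at-ones (suc k) S (λ u → ∑[ a < n ] (r a * u a))
        (weighted-linear r)
        (<-≤-trans (subst (0ℚ <_) (sym (*-identityʳ (r o))) 0<ro)
          (term≤∑ (λ a → subst (0ℚ ≤_) (sym (*-identityʳ (r a))) (∑-nonNeg (0≤hessian (suc k) S a))) o))
        (nonPositive-on-mean-zero (hessian-sym (suc k) S) (0≤hessian (suc k) S)
          (λ a → *-nonNeg (0≤β a) (<⇒≤ (0<g a))) DrA (*-pos 0<βo (0<g o)) 0<ro 0<δ column gap)
        where
        G⁻¹ : ∀ a → ∃ λ q → 0ℚ < q × q * G (suc (suc k)) (S ⊕ a) ≡ 1ℚ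
        G⁻¹ a = inverse (G-pos (suc (suc k)) (S ⊕ a))

        g : Fin n → ℚ
        g a = proj₁ (G⁻¹ a)
        0<g : ∀ a → 0ℚ < g a
        0<g a = proj₁ (proj₂ (G⁻¹ a))
        gG≡1 : ∀ a → g a * G (suc (suc k)) (S ⊕ a) ≡ 1ℚ
        gG≡1 a = proj₂ (proj₂ (G⁻¹ a))

        lower = G-lower (suc k)
        upper = G-upper (suc (suc k))
        upper⁻¹ = inverse (proj₁ (proj₂ upper))

        -- The entry (o, b) of the Hessian is `t * α S b * G (suc k) (S ⊕ b)` and the row sum at b
        -- is `α S b * G (suc (suc k)) (S ⊕ b)`. Bounding the two G uniformly gives δ.
        lo hi⁻¹ δ : ℚ
        lo   = proj₁ lower
        hi⁻¹ = proj₁ upper⁻¹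
        δ    = t * lo * hi⁻¹

        0<δ : 0ℚ < δ
        0<δ = *-pos (*-pos 0<t (proj₁ (proj₂ lower))) (proj₁ (proj₂ upper⁻¹))

        open SpectralGap (hessian (suc k) S) (λ a → β a * g a) o δ

        r≡ : ∀ a → r a ≡ α S a * G (suc (suc k)) (S ⊕ a)
        r≡ = hessian-rowSum (suc k) S

        0<ro : 0ℚ < r o
        0<ro = subst (0ℚ <_) (sym (r≡ o))
          (*-pos (subst (0ℚ <_) (sym (α-o S)) 0<t) (G-pos (suc (suc k)) (S ⊕ o)))

        DrA : ∀ a b → β a * g a * r a * hessian (suc k) S a b ≡ hessian (suc k) S a b
        DrA a b = begin
          β a * g a * r a * (α S a * α (S ⊕ a) b * G (suc k) (S ⊕ a ⊕ b))
            ≡⟨ cong (λ z → β a * g a * z * (α S a * α (S ⊕ a) b * G (suc k) (S ⊕ a ⊕ b))) (r≡ a) ⟩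
          β a * g a * (α S a * G (suc (suc k)) (S ⊕ a)) * (α S a * α (S ⊕ a) b * G (suc k) (S ⊕ a ⊕ b))
            ≡⟨ rearr (β a) (g a) (α S a) (G (suc (suc k)) (S ⊕ a)) (α (S ⊕ a) b) (G (suc k) (S ⊕ a ⊕ b)) ⟩
          g a * G (suc (suc k)) (S ⊕ a) * (β a * α S a * α S a) * α (S ⊕ a) b * G (suc k) (S ⊕ a ⊕ b)
            ≡⟨ cong₂ (λ y z → y * z * α (S ⊕ a) b * G (suc k) (S ⊕ a ⊕ b)) (gG≡1 a) (βα² S a) ⟩
          1ℚ * α S a * α (S ⊕ a) b * G (suc k) (S ⊕ a ⊕ b)
            ≡⟨ cong (λ z → z * α (S ⊕ a) b * G (suc k) (S ⊕ a ⊕ b)) (*-identityˡ (α S a)) ⟩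
          α S a * α (S ⊕ a) b * G (suc k) (S ⊕ a ⊕ b) ∎
          where
          open ≡-Reasoning
          rearr : ∀ β g a G b H → β * g * (a * G) * (a * b * H) ≡ g * G * (β * a * a) * b * H
          rearr = solve-∀ ℚ-ring

        column : ∀ b → δ * r b ≤ hessian (suc k) S o b
        column b = subst₂ _≤_ (sym (trans (cong (δ *_) (r≡ b)) (rearr₁ (t * lo) hi⁻¹ (α S b) _)))
          (trans (rearr₂ t (α S b) _) (cong₂ _*_
            (cong₂ _*_ (sym (α-o S)) (cong (λ s → α s b) (sym (⊕-o S))))
            (cong (λ s → G (suc k) (s ⊕ b)) (sym (⊕-o S)))))
          (*-monoʳ-≤ (α S b) (0≤α S b) (≤-trans
            (subst₂ _≤_ refl (trans (cong (t * lo *_) (proj₂ (proj₂ upper⁻¹))) (*-identityʳ (t * lo)))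
              (*-monoʳ-≤ (t * lo) (<⇒≤ (*-pos 0<t (proj₁ (proj₂ lower))))
                (*-monoʳ-≤ hi⁻¹ (<⇒≤ (proj₁ (proj₂ upper⁻¹))) (proj₂ (proj₂ upper) (S ⊕ b)))))
            (*-monoʳ-≤ t (<⇒≤ 0<t) (proj₂ (proj₂ lower) (S ⊕ b)))))
          where
          rearr₁ : ∀ s h a G → s * h * (a * G) ≡ a * (s * (h * G))
          rearr₁ = solve-∀ ℚ-ring
          rearr₂ : ∀ t a G → a * (t * G) ≡ t * a * G
          rearr₂ = solve-∀ ℚ-ring

        -- The inductive inequality at `S ⊕ a` is divided by its G, multiplied by `α S a` and summed
        -- over a. The left side is the form at S by `hessian-suc`, the right side is `B (T u) u`.
        gap : ∀ u → Q (suc k) S u u ≤ Q (suc k) S (T u) u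
        gap u = subst₂ _≤_ (sym (B-∑ (α S) (λ a → hessian k (S ⊕ a)) (hessian-suc k S) u u)) refl
          (∑-mono λ a → subst₂ _≤_ (cancel a) (collect a)
            (*-monoʳ-≤ (α S a * g a) (*-nonNeg (0≤α S a) (<⇒≤ (0<g a))) (hyperbolic k (S ⊕ a) u)))
          where
          cancel : ∀ a → α S a * g a * (Q k (S ⊕ a) u u * G (suc (suc k)) (S ⊕ a)) ≡ α S a * Q k (S ⊕ a) u u
          cancel a = trans (rearr (α S a) (g a) (Q k (S ⊕ a) u u) (G (suc (suc k)) (S ⊕ a)))
            (trans (cong (_* (α S a * Q k (S ⊕ a) u u)) (gG≡1 a)) (*-identityˡ (α S a * Q k (S ⊕ a) u u)))
            where
            rearr : ∀ a g q G → a * g * (q * G) ≡ g * G * (a * q)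
            rearr = solve-∀ ℚ-ring
          collect : ∀ a → let l = L (suc k) (S ⊕ a) u in
            α S a * g a * (l * l) ≡ T u a * BilinearForm.A∙_ (hessian (suc k) S) u a
          -- Both `T u a` and the Hessian applied to u carry a factor `α S a`; `βα²` provides the
          -- second one.
          collect a = trans (cong (λ z → z * g a * (l * l)) (sym (βα² S a)))
            (trans (rearr (β a) (α S a) (g a) l)
              (cong (λ z → β a * g a * z * z) (sym (hessian∙ (suc k) S u a))))
            where
            l = L (suc k) (S ⊕ a) u
            rearr : ∀ β a g l → β * a * a * g * (l * l) ≡ β * g * (a * l) * (a * l)
            rearr = solve-∀ ℚ-ring

      -- Take the unit vector at o in `hyperbolic`. A step at o multiplies by t and leaves S fixed,
      -- so the form becomes t² G_k and the linear term t G_(k+1); then t² cancels.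
      G-logConcave : ∀ k S → G k S * G (suc (suc k)) S ≤ G (suc k) S * G (suc k) S
      G-logConcave k S = *-cancel-≤ (t * t) (*-pos 0<t 0<t)
        (subst₂ _≤_ (trans (cong (_* G (suc (suc k)) S) Qee) (*-assoc (t * t) _ _))
          (trans (cong₂ _*_ Le Le) (rearr t (G (suc k) S)))
          (hyperbolic k S e))
        where
        e : Fin n → ℚ
        e a = if does (a Fin.≟ o) then 1ℚ else 0ℚ

        e-o : e o ≡ 1ℚ
        e-o = cong (if_then 1ℚ else 0ℚ) (dec-true (o Fin.≟ o) refl)

        e-other : ∀ a → a ≢ o → e a ≡ 0ℚ
        e-other a a≢o = cong (if_then 1ℚ else 0ℚ) (dec-false (a Fin.≟ o) a≢o)

        ∑-e : ∀ (f : Fin n → ℚ) → ∑[ a < n ] (f a * e a) ≡ f o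
        ∑-e f = trans (∑-single o (λ a a≢o → trans (cong (f a *_) (e-other a a≢o)) (*-zeroʳ (f a))))
          (trans (cong (f o *_) e-o) (*-identityʳ (f o)))

        Le : L (suc k) S e ≡ t * G (suc k) S
        Le = trans (∑-e (λ a → α S a * G (suc k) (S ⊕ a))) (cong₂ (λ w s → w * G (suc k) s) (α-o S) (⊕-o S))

        Qee : Q k S e e ≡ t * t * G k S
        Qee = trans (sum-cong-≗ (λ a → *-comm (e a) _)) (trans (∑-e (BilinearForm.A∙_ (hessian k S) e)) (trans (∑-e (hessian k S o))
          (cong₂ _*_ (cong₂ _*_ (α-o S) (trans (cong (λ s → α s o) (⊕-o S)) (α-o S)))
            (cong (G k) (trans (⊕-o (S ⊕ o)) (⊕-o S))))))

        rearr : ∀ t g → t * g * (t * g) ≡ t * t * (g * g)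
        rearr = solve-∀ ℚ-ring

  -- Nonnegativity of the form of a partial equivalence relation.

  B-rankOne : ∀ {n} (a u : Fin n → ℚ) → let s = ∑[ i < n ] (a i * u i) in
              BilinearForm.B (λ i j → a i * a j) u u ≡ s * s
  B-rankOne {n} a u = trans
    (sum-cong-≗ (λ i → trans (cong (u i *_) (trans (sum-cong-≗ (λ j → *-assoc (a i) (a j) (u j)))
        (∑-factorˡ (a i) (λ j → a j * u j))))
      (rearr (u i) (a i) (∑[ j < n ] (a j * u j)))))
    (sym (*-distribʳ-sum (∑[ j < n ] (a j * u j)) (λ i → a i * u i)))
    where
    rearr : ∀ u a s → u * (a * s) ≡ a * u * s
    rearr = solve-∀ ℚ-ring

  B-+ : ∀ {n} (A C D : Fin n → Fin n → ℚ) → (∀ i j → A i j ≡ C i j + D i j) →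
        ∀ u v → BilinearForm.B A u v ≡ BilinearForm.B C u v + BilinearForm.B D u v
  B-+ {n} A C D A≡C+D u v = trans
    (sum-cong-≗ (λ i → trans (cong (u i *_) (trans
        (sum-cong-≗ (λ j → trans (cong (_* v j) (A≡C+D i j)) (*-distribʳ-+ (v j) (C i j) (D i j))))
        (∑-distrib-+ (λ j → C i j * v j) (λ j → D i j * v j))))
      (*-distribˡ-+ (u i) (∑[ j < n ] (C i j * v j)) (∑[ j < n ] (D i j * v j)))))
    (∑-distrib-+ (λ i → u i * ∑[ j < n ] (C i j * v j)) (λ i → u i * ∑[ j < n ] (D i j * v j)))

  B-drop : ∀ {n} (A : Fin (suc n) → Fin (suc n) → ℚ) → (∀ j → A zero j ≡ 0ℚ) → (∀ i → A i zero ≡ 0ℚ) →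
           ∀ u → BilinearForm.B A u u ≡ BilinearForm.B (λ i j → A (suc i) (suc j)) (u ∘ suc) (u ∘ suc)
  B-drop {n} A row column u = trans
    (cong₂ _+_ (trans (cong (u zero *_) (∑-zero (λ j → vanish (row j) (u j)))) (*-zeroʳ (u zero)))
      (sum-cong-≗ (λ i → cong (u (suc i) *_) (trans
        (cong (_+ ∑[ j < n ] (A (suc i) (suc j) * u (suc j))) (vanish (column (suc i)) (u zero)))
        (+-identityˡ (∑[ j < n ] (A (suc i) (suc j) * u (suc j))))))))
    (+-identityˡ (∑[ i < n ] (u (suc i) * ∑[ j < n ] (A (suc i) (suc j) * u (suc j)))))
    where
    vanish : ∀ {a} → a ≡ 0ℚ → ∀ x → a * x ≡ 0ℚ
    vanish refl x = *-zeroˡ x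

  -- The class of zero contributes a square; what remains lives on one index fewer.
  partialEquivalence-nonNeg : ∀ {r n} {R : Fin n → Fin n → Set r} (R? : ∀ i j → Dec (R i j)) →
    (∀ {i j} → R i j → R j i) → (∀ {i j k} → R i j → R j k → R i k) →
    ∀ u → 0ℚ ≤ BilinearForm.B (λ i j → indicator (R? i j) · 1ℚ) u u
  partialEquivalence-nonNeg {n = zero}  R? R-sym R-trans u = ≤-refl
  partialEquivalence-nonNeg {r} {suc n} {R} R? R-sym R-trans u = subst (0ℚ ≤_)
    (sym (trans (B-+ E (λ i j → E zero i * E zero j) E′ split u u) (cong₂ _+_ (B-rankOne (E zero) u)
      (B-drop E′ (λ j → cong (_· 1ℚ) (indicator-false (R′? zero j) (λ (p , ¬p) → ¬p (R-trans p (R-sym p)))))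
        (λ i → cong (_· 1ℚ) (indicator-false (R′? i zero) (λ (p , ¬p) → ¬p (R-sym p)))) u))))
    (+-nonNeg (square-nonNeg (∑[ i < suc n ] (E zero i * u i)))
      (partialEquivalence-nonNeg (λ i j → R′? (suc i) (suc j))
        (λ (p , ¬p) → R-sym p , λ q → ¬p (R-trans q (R-sym p)))
        (λ (p , ¬p) (q , _) → R-trans p q , ¬p) (u ∘ suc)))
    where
    -- It is enough to keep i outside the class of zero: being related to i, j is then outside as
    -- well.
    R′ : Fin (suc n) → Fin (suc n) → Set r
    R′ i j = R i j × ¬ R zero i
    R′? : ∀ i j → Dec (R′ i j)
    R′? i j = R? i j ×-dec ¬? (R? zero i)
    E E′ : Fin (suc n) → Fin (suc n) → ℚ
    E i j  = indicator (R? i j) · 1ℚ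
    E′ i j = indicator (R′? i j) · 1ℚ
    splitℕ : ∀ {p q s} {P : Set p} {Q : Set q} {S : Set s} (P? : Dec P) (Q? : Dec Q) (S? : Dec S) →
             (Q → S → P) → (P → Q → S) →
             indicator P? ≡ indicator Q? ℕ.* indicator S? ℕ.+ indicator (P? ×-dec ¬? Q?)
    splitℕ (yes p) (yes q) S? f g = cong (λ z → z ℕ.+ 0 ℕ.+ 0) (sym (indicator-true S? (g p q)))
    splitℕ (yes p) (no ¬q) S? f g = refl
    splitℕ (no ¬p) (yes q) S? f g = cong (λ z → z ℕ.+ 0 ℕ.+ 0) (sym (indicator-false S? (λ s → ¬p (f q s))))
    splitℕ (no ¬p) (no ¬q) S? f g = refl
    split : ∀ i j → E i j ≡ E zero i * E zero j + E′ i j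
    split i j = trans (cong (_· 1ℚ) (splitℕ (R? i j) (R? zero i) (R? zero j)
        (λ p q → R-trans (R-sym p) q) (λ p q → R-trans q p)))
      (trans (×-homo-+ 1ℚ (indicator (R? zero i) ℕ.* indicator (R? zero j)) _)
        (cong (_+ E′ i j) (×1-homo-* (indicator (R? zero i)) (indicator (R? zero j)))))

  ·1-∑-* : ∀ {n} (f g : Fin n → ℕ) →
           ℕ∑.sum (λ i → f i ℕ.* g i) · 1ℚ ≡ ∑[ i < n ] (f i · 1ℚ * (g i · 1ℚ))
  ·1-∑-* {zero}  f g = refl
  ·1-∑-* {suc n} f g = trans (×-homo-+ 1ℚ (f zero ℕ.* g zero) _)
    (cong₂ _+_ (×1-homo-* (f zero) (g zero)) (·1-∑-* (f ∘ suc) (g ∘ suc)))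


  -- Walks in a matroid and the limit t → 0.

  module MatroidWalks {m : ℕ} {ℓ : Level} (M : Matroid m ℓ) where
    open Extensions M

    weight : ℚ → Subset m → Fin (suc m) → ℚ
    weight t S zero    = t
    weight t S (suc i) = χ S i · 1ℚ

    module _ (t : ℚ) where
      open WeightedWalks extend (weight t) using (G; Q; hessian)

      weight-comm : ∀ S a b → weight t S a * weight t (extend S a) b ≡ weight t S b * weight t (extend S b) a
      weight-comm S zero    zero    = refl
      weight-comm S zero    (suc j) = *-comm t (χ S j · 1ℚ)
      weight-comm S (suc i) zero    = *-comm (χ S i · 1ℚ) t
      weight-comm S (suc i) (suc j) = trans (sym (×1-homo-* (χ S i) _))
        (trans (cong (_· 1ℚ) (χ-comm S i j)) (×1-homo-* (χ S j) _))

      parallelForm : Subset m → Fin (suc m) → Fin (suc m) → ℚ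
      parallelForm S zero    b       = 0ℚ
      parallelForm S (suc i) zero    = 0ℚ
      parallelForm S (suc i) (suc j) = indicator (parallel? S i j) · 1ℚ

      weight-split : ∀ S a b → weight t S a * weight t S b ≡
        weight t S a * weight t (extend S a) b * 1ℚ + parallelForm S a b
      weight-split S zero    b       = trans (sym (*-identityʳ (t * weight t S b))) (sym (+-identityʳ (t * weight t S b * 1ℚ)))
      weight-split S (suc i) zero    = trans (sym (*-identityʳ (χ S i · 1ℚ * t))) (sym (+-identityʳ (χ S i · 1ℚ * t * 1ℚ)))
      weight-split S (suc i) (suc j) = trans (sym (×1-homo-* (χ S i) (χ S j)))
        (trans (cong (_· 1ℚ) (χ-split S i j))
          (trans (×-homo-+ 1ℚ (χ S i ℕ.* χ (S ∪ ⁅ i ⁆) j) _)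
            (cong (_+ indicator (parallel? S i j) · 1ℚ)
              (trans (×1-homo-* (χ S i) (χ (S ∪ ⁅ i ⁆) j)) (sym (*-identityʳ _))))))

      -- On this hyperplane the rank-one form vanishes, so the two-step form is minus the form of
      -- parallelism, a partial equivalence relation.
      Q₀-nonPos : ∀ S u → ∑[ a < suc m ] (weight t S a * u a) ≡ 0ℚ → Q 0 S u u ≤ 0ℚ
      Q₀-nonPos S u ℓu≡0 = ≤-fromDiff parallel-nonNeg
        (trans (cong (_- Q 0 S u u) (sym total)) (cancel (Q 0 S u u) (BilinearForm.B (parallelForm S) u u)))
        where
        parallel-nonNeg : 0ℚ ≤ BilinearForm.B (parallelForm S) u u
        parallel-nonNeg = subst (0ℚ ≤_) (sym (B-drop (parallelForm S) (λ j → refl) (λ { zero → refl ; (suc i) → refl }) u))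
          (partialEquivalence-nonNeg (parallel? S) parallel-sym parallel-trans (u ∘ suc))
        total : Q 0 S u u + BilinearForm.B (parallelForm S) u u ≡ 0ℚ
        total = trans (sym (B-+ (λ a b → weight t S a * weight t S b) (hessian 0 S) (parallelForm S) (weight-split S) u u)) (trans (B-rankOne (weight t S) u) (cong₂ _*_ ℓu≡0 ℓu≡0))
        cancel : ∀ q p → (q + p) - q ≡ p
        cancel = solve-∀ ℚ-ring

      weight-nonNeg : 0ℚ ≤ t → ∀ S a → 0ℚ ≤ weight t S a
      weight-nonNeg 0≤t S zero    = 0≤t
      weight-nonNeg 0≤t S (suc i) = ·1-nonNeg (χ S i)

      weight≤1 : t ≤ 1ℚ → ∀ S a → weight t S a ≤ 1ℚ
      weight≤1 t≤1 S zero    = t≤1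
      weight≤1 t≤1 S (suc i) = ·1-mono-≤ (indicator≤1 (extends? S i))

      G-logConcave : 0ℚ < t → t ≤ 1ℚ → ∀ k S → G k S * G (suc (suc k)) S ≤ G (suc k) S * G (suc k) S
      G-logConcave 0<t t≤1 = WeightedWalks.LogConcavity.G-logConcave extend (weight t)
        extend-comm weight-comm (weight-nonNeg (<⇒≤ 0<t)) (weight≤1 t≤1) β 0≤β βα² zero 0<s
        (λ S → refl) t 0<t (λ S → refl) Q₀-nonPos
        where
        t⁻¹ = inverse 0<t
        0<s = proj₁ (proj₂ t⁻¹)
        -- The extra variable always has weight t, so its inverse is taken; the other weights are 0
        -- or 1, for which 1 serves.
        β : Fin (suc m) → ℚ
        β zero    = proj₁ t⁻¹
        β (suc i) = 1ℚ
        0≤β : ∀ a → 0ℚ ≤ β a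
        0≤β zero    = <⇒≤ 0<s
        0≤β (suc i) = nonNegative⁻¹ 1ℚ
        βα² : ∀ S a → β a * weight t S a * weight t S a ≡ weight t S a
        βα² S zero    = trans (cong (_* t) (proj₂ (proj₂ t⁻¹))) (*-identityˡ t)
        βα² S (suc i) = trans (cong (_* (χ S i · 1ℚ)) (*-identityˡ (χ S i · 1ℚ)))
          (trans (sym (×1-homo-* (χ S i) (χ S i))) (cong (_· 1ℚ) (indicator-idem (extends? S i))))

    private
      -- An upper bound, for t ≤ 1, on the first derivative in t of the walk weights.
      slope : ℕ → Subset m → ℕ
      slope zero    S = 0
      slope (suc k) S = (orderedExtensions k S ℕ.+ slope k S) ℕ.+ ℕ∑.sum (λ i → χ S i ℕ.* slope k (S ∪ ⁅ i ⁆))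

      c d : ℕ → Subset m → ℚ
      c k S = orderedExtensions k S · 1ℚ
      d k S = slope k S · 1ℚ

      module _ (t : ℚ) (0≤t : 0ℚ ≤ t) (t≤1 : t ≤ 1ℚ) where
        open WeightedWalks extend (weight t) using (G)

        G-lowerBound : ∀ k S → c k S ≤ G k S
        G-lowerBound zero    S = ≤-refl
        G-lowerBound (suc k) S = subst (_≤ G (suc k) S)
          (trans (+-identityˡ (∑[ i < m ] (χ S i · 1ℚ * c k (S ∪ ⁅ i ⁆))))
            (sym (·1-∑-* (χ S) (λ i → orderedExtensions k (S ∪ ⁅ i ⁆)))))
          (+-mono-≤ (*-nonNeg 0≤t (≤-trans (·1-nonNeg (orderedExtensions k S)) (G-lowerBound k S)))
            (∑-mono (λ i → *-monoʳ-≤ (χ S i · 1ℚ) (·1-nonNeg (χ S i)) (G-lowerBound k (S ∪ ⁅ i ⁆)))))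

        -- The extra step contributes at most t (c + t d) ≤ t (c + d), where t ≤ 1 enters; the other
        -- steps pass their slopes on. This is the recursion of `slope`.
        G-upperBound : ∀ k S → G k S ≤ c k S + t * d k S
        G-upperBound zero    S = ≤-reflexive (sym (trans (cong (1ℚ +_) (*-zeroʳ t)) (+-identityʳ 1ℚ)))
        G-upperBound (suc k) S = ≤-trans
          (+-mono-≤ (*-monoʳ-≤ t 0≤t (≤-trans (G-upperBound k S) (+-monoʳ-≤ (c k S) td≤d)))
            (∑-mono (λ i → *-monoʳ-≤ (χ S i · 1ℚ) (·1-nonNeg (χ S i)) (G-upperBound k (S ∪ ⁅ i ⁆)))))
          (≤-reflexive (trans (cong (t * (c k S + d k S) +_) expand)
            (trans (rearr t (c k S + d k S) (c (suc k) S) d′)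
              (cong (λ z → c (suc k) S + t * z) (sym d-suc)))))
          where
          td≤d : t * d k S ≤ d k S
          td≤d = subst (t * d k S ≤_) (*-identityˡ (d k S))
            (*-monoʳ-≤-nonNeg (d k S) ⦃ nonNegative (·1-nonNeg (slope k S)) ⦄ t≤1)
          d′ : ℚ
          d′ = ∑[ i < m ] (χ S i · 1ℚ * d k (S ∪ ⁅ i ⁆))
          d-suc : d (suc k) S ≡ (c k S + d k S) + d′
          d-suc = trans (×-homo-+ 1ℚ (orderedExtensions k S ℕ.+ slope k S) _)
            (cong₂ _+_ (×-homo-+ 1ℚ (orderedExtensions k S) (slope k S)) (·1-∑-* (χ S) (λ i → slope k (S ∪ ⁅ i ⁆))))
          distr : ∀ x c t d → x * (c + t * d) ≡ 1ℚ * (x * c) + t * (x * d)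
          distr = solve-∀ ℚ-ring
          expand : ∑[ i < m ] (χ S i · 1ℚ * (c k (S ∪ ⁅ i ⁆) + t * d k (S ∪ ⁅ i ⁆))) ≡ 1ℚ * c (suc k) S + t * d′
          expand = trans (sum-cong-≗ (λ i → distr (χ S i · 1ℚ) (c k (S ∪ ⁅ i ⁆)) t (d k (S ∪ ⁅ i ⁆))))
            (trans (∑-linear 1ℚ t (λ i → χ S i · 1ℚ * c k (S ∪ ⁅ i ⁆)) (λ i → χ S i · 1ℚ * d k (S ∪ ⁅ i ⁆)))
              (cong (λ z → 1ℚ * z + t * d′) (sym (·1-∑-* (χ S) (λ i → orderedExtensions k (S ∪ ⁅ i ⁆))))))
          rearr : ∀ t x c d → t * x + (1ℚ * c + t * d) ≡ c + t * (x + d)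
          rearr = solve-∀ ℚ-ring

    -- Let t = 1/(n + 1) tend to 0.
    orderedExtensions-logConcave : ∀ k S →
      orderedExtensions k S ℕ.* orderedExtensions (suc (suc k)) S ℕ.≤ orderedExtensions (suc k) S ℕ.* orderedExtensions (suc k) S
    orderedExtensions-logConcave k S = ·1-cancel-≤ (subst₂ _≤_ (sym (×1-homo-* (orderedExtensions k S) _))
      (sym (×1-homo-* (orderedExtensions (suc k) S) _)) (≤-fromDiff (neg-antimono-≤ (archimedean bound)) (flip xz (y * y))))
      where
      y K xz b : ℚ
      y  = c (suc k) S
      K  = d (suc k) S
      xz = c k S * c (suc (suc k)) S
      b  = (y * K + y * K) + K * K
      0≤y : 0ℚ ≤ y
      0≤y = ·1-nonNeg (orderedExtensions (suc k) S)
      0≤K : 0ℚ ≤ K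
      0≤K = ·1-nonNeg (slope (suc k) S)
      flip : ∀ a b → b - a ≡ - (a - b)
      flip = solve-∀ ℚ-ring
      -- Squeezing gives xz ≤ G_k G_(k+2) ≤ G_(k+1)² ≤ (y + tK)². Since (y + tK)² - y² = t (2yK +
      -- tK²), multiplying by N = 1/t leaves at most b, whatever n is.
      bound : ∀ n → n · 1ℚ * (xz - y * y) ≤ b
      bound zero    = subst (_≤ b) (sym (*-zeroˡ (xz - y * y)))
        (+-nonNeg (+-nonNeg (*-nonNeg 0≤y 0≤K) (*-nonNeg 0≤y 0≤K)) (*-nonNeg 0≤K 0≤K))
      bound (suc n) with inverse (·1-suc-pos n)
      ... | t , 0<t , tN≡1 = ≤-trans
        (*-monoʳ-≤ N (·1-nonNeg (suc n)) (+-monoˡ-≤ (- (y * y)) xz≤))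
        (subst₂ _≤_ (sym Nsq) refl (+-monoʳ-≤ (y * K + y * K)
          (subst (t * (K * K) ≤_) (*-identityˡ (K * K))
            (*-monoʳ-≤-nonNeg (K * K) ⦃ nonNegative (*-nonNeg 0≤K 0≤K) ⦄ t≤1))))
        where
        N : ℚ
        N = suc n · 1ℚ
        t≤1 : t ≤ 1ℚ
        t≤1 = subst₂ _≤_ (*-identityʳ t) tN≡1 (*-monoʳ-≤ t (<⇒≤ 0<t)
          (·1-mono-≤ {1} {suc n} (s≤s z≤n)))
        open WeightedWalks extend (weight t) using (G)
        lower : ∀ k → c k S ≤ G k S
        lower k = G-lowerBound t (<⇒≤ 0<t) t≤1 k S
        0≤c : ∀ k → 0ℚ ≤ c k S
        0≤c k = ·1-nonNeg (orderedExtensions k S)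
        upper : G (suc k) S ≤ y + t * K
        upper = G-upperBound t (<⇒≤ 0<t) t≤1 (suc k) S
        0≤G : 0ℚ ≤ G (suc k) S
        0≤G = ≤-trans (0≤c (suc k)) (lower (suc k))
        xz≤ : xz ≤ (y + t * K) * (y + t * K)
        xz≤ = ≤-trans (*-mono-≤ (0≤c k) (≤-trans (0≤c (suc (suc k))) (lower (suc (suc k))))
            (lower k) (lower (suc (suc k))))
          (≤-trans (G-logConcave t 0<t t≤1 k S) (*-mono-≤ 0≤G (≤-trans 0≤G upper) upper upper))
        Nsq : N * ((y + t * K) * (y + t * K) - y * y) ≡ (y * K + y * K) + t * (K * K)
        Nsq = trans (rearr N y t K) (trans (cong (_* ((y * K + y * K) + t * (K * K))) tN≡1) (*-identityˡ _))
          where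
          rearr : ∀ N y t K → N * ((y + t * K) * (y + t * K) - y * y) ≡ t * N * ((y * K + y * K) + t * (K * K))
          rearr = solve-∀ ℚ-ring

-- From ordered extensions to numbers of independent sets.

module IndependentSetCounts where

  open import Data.Nat.Base using (_+_; _*_; _≤_; _!)
  open import Data.Nat.Properties
  open import Data.Nat.Tactic.RingSolver using (solve-∀)
  open ℕ∑ using (sum; sum-cong-≗; ∑-distrib-+; *-distribˡ-sum)

  listSum : ∀ {a} {A : Set a} → List A → (A → ℕ) → ℕ
  listSum xs f = sumˡ (List.map f xs)

  listSum-cong : ∀ {a} {A : Set a} (xs : List A) {f g : A → ℕ} → (∀ x → f x ≡ g x) → listSum xs f ≡ listSum xs g
  listSum-cong xs f≗g = cong sumˡ (map-cong f≗g xs)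

  listSum-*ˡ : ∀ {a} {A : Set a} (xs : List A) c (f : A → ℕ) → listSum xs (λ x → c * f x) ≡ c * listSum xs f
  listSum-*ˡ []       c f = sym (*-zeroʳ c)
  listSum-*ˡ (x ∷ xs) c f = trans (cong (c * f x +_) (listSum-*ˡ xs c f)) (sym (*-distribˡ-+ c (f x) (listSum xs f)))

  ∑-listSum-comm : ∀ {a} {A : Set a} {n} (xs : List A) (f : Fin n → A → ℕ) →
                   sum (λ i → listSum xs (f i)) ≡ listSum xs (λ x → sum (λ i → f i x))
  ∑-listSum-comm {n = zero}  []       f = refl
  ∑-listSum-comm {n = suc n} []       f = ∑-listSum-comm {n = n} [] (f ∘ suc)
  ∑-listSum-comm (x ∷ xs) f = trans (∑-distrib-+ (λ i → f i x) (λ i → listSum xs (f i)))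
    (cong (sum (λ i → f i x) +_) (∑-listSum-comm xs f))

  listSum-zero : ∀ {a} {A : Set a} {xs : List A} {f : A → ℕ} → All (λ x → f x ≡ 0) xs → listSum xs f ≡ 0
  listSum-zero All.[]          = refl
  listSum-zero (fx≡0 All.∷ ps) = cong₂ _+_ fx≡0 (listSum-zero ps)

  listSum-single : ∀ {a} {A : Set a} {xs : List A} {f : A → ℕ} {x} → Unique xs → x ∈ˡ xs →
                   (∀ y → x ≢ y → f y ≡ 0) → listSum xs f ≡ f x
  listSum-single {f = f} {x} (x≢ ∷ _) (here refl) f≡0 =
    trans (cong (f x +_) (listSum-zero (All.map (f≡0 _) x≢))) (+-identityʳ (f x))
  listSum-single (y≢ ∷ unique) (there x∈) f≡0 =
    cong₂ _+_ (f≡0 _ (λ x≡y → All.lookup y≢ x∈ (sym x≡y))) (listSum-single unique x∈ f≡0)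

  length-filter-filter : ∀ {a p q} {A : Set a} {P : Pred A p} {Q : Pred A q}
    (P? : Decidable P) (Q? : Decidable Q) xs →
    List.length (List.filter Q? (List.filter P? xs)) ≡ listSum xs (λ x → indicator (P? x ×-dec Q? x))
  length-filter-filter P? Q? []       = refl
  length-filter-filter P? Q? (x ∷ xs) with P? x
  ... | no _  = length-filter-filter P? Q? xs
  ... | yes _ with Q? x
  ...   | yes _ = cong suc (length-filter-filter P? Q? xs)
  ...   | no _  = length-filter-filter P? Q? xs

  ⊆∧∣∣≡⇒≡ : ∀ {m} {S T : Subset m} → S ⊆ T → ∣ T ∣ ≡ ∣ S ∣ → S ≡ T
  ⊆∧∣∣≡⇒≡ {S = []}        {[]}        S⊆T eq = refl
  ⊆∧∣∣≡⇒≡ {S = true ∷ S}  {true ∷ T}  S⊆T eq = cong (true ∷_) (⊆∧∣∣≡⇒≡ (drop-∷-⊆ S⊆T) (suc-injective eq))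
  ⊆∧∣∣≡⇒≡ {S = true ∷ S}  {false ∷ T} S⊆T eq with S⊆T Vec.here
  ... | ()
  ⊆∧∣∣≡⇒≡ {S = false ∷ S} {true ∷ T}  S⊆T eq =
    contradiction (subst (_≤ ∣ T ∣) (sym eq) (p⊆q⇒∣p∣≤∣q∣ (drop-∷-⊆ S⊆T))) 1+n≰n
  ⊆∧∣∣≡⇒≡ {S = false ∷ S} {false ∷ T} S⊆T eq = cong (false ∷_) (⊆∧∣∣≡⇒≡ (drop-∷-⊆ S⊆T) eq)

  InDifference? : ∀ {m} (S T : Subset m) i → Dec (i ∈ T × i ∉ S)
  InDifference? S T i = (i ∈? T) ×-dec ¬? (i ∈? S)

  ∣T∣≡∣S∣+∑ : ∀ {m} {S T : Subset m} → S ⊆ T → ∣ T ∣ ≡ ∣ S ∣ + sum (λ i → indicator (InDifference? S T i))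
  ∣T∣≡∣S∣+∑ {S = []}    {[]}    S⊆T = refl
  ∣T∣≡∣S∣+∑ {S = x ∷ S} {y ∷ T} S⊆T = trans (head x y S⊆T)
    (cong (λ z → ∣ x ∷ S ∣ + (indicator (InDifference? (x ∷ S) (y ∷ T) zero) + z))
      (sum-cong-≗ (λ i → indicator-⇔ (InDifference? S T i) (InDifference? (x ∷ S) (y ∷ T) (suc i))
        (λ (i∈T , i∉S) → Vec.there i∈T , λ { (Vec.there i∈S) → i∉S i∈S })
        (λ { (Vec.there i∈T , i∉S) → i∈T , i∉S ∘ Vec.there }))))
    where
    IH = ∣T∣≡∣S∣+∑ (drop-∷-⊆ S⊆T)
    head : ∀ x y → (x ∷ S) ⊆ (y ∷ T) → ∣ y ∷ T ∣ ≡
      ∣ x ∷ S ∣ + (indicator (InDifference? (x ∷ S) (y ∷ T) zero) + sum (λ i → indicator (InDifference? S T i)))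
    head true  true  _ = cong suc IH
    head true  false S⊆T with S⊆T Vec.here
    ... | ()
    head false true  _ = trans (cong suc IH) (sym (+-suc ∣ S ∣ _))
    head false false _ = IH

  module Counting {m : ℕ} {ℓ : Level} (M : Matroid m ℓ) where
    open Matroid M
    open Extensions M
    open RationalForms.MatroidWalks M using (orderedExtensions-logConcave)

    Above : ℕ → Subset m → Subset m → Set ℓ
    Above k S T = S ⊆ T × Indep T × ∣ T ∣ ≡ ∣ S ∣ + k

    above? : ∀ k S T → Dec (Above k S T)
    above? k S T = (S ⊆? T) ×-dec (indep? T ×-dec (∣ T ∣ ≟ ∣ S ∣ + k))

    numAbove : ℕ → Subset m → ℕ
    numAbove k S = listSum (allSubsets m) (λ T → indicator (above? k S T))

    numAbove-⊥ : ∀ k → numAbove k ⊥ ≡ numIndep M k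
    numAbove-⊥ k = trans (listSum-cong (allSubsets m) (λ T → indicator-⇔ (above? k ⊥ T) _
        (λ (_ , indep , eq) → indep , trans eq (cong (_+ k) (∣⊥∣≡0 m)))
        (λ (indep , eq) → ⊥⊆ , indep , trans eq (sym (cong (_+ k) (∣⊥∣≡0 m))))))
      (sym (length-filter-filter indep? (λ S → ∣ S ∣ ≟ k) (allSubsets m)))

    numAbove-zero : ∀ {S} → Indep S → numAbove 0 S ≡ 1
    numAbove-zero {S} indep = trans
      (listSum-single (allSubsets-unique m) (allSubsets-complete S) (λ T S≢T → indicator-false (above? 0 S T)
        (λ (S⊆T , _ , eq) → S≢T (⊆∧∣∣≡⇒≡ S⊆T (trans eq (+-identityʳ ∣ S ∣))))))
      (indicator-true (above? 0 S S) (⊆-refl , indep , sym (+-identityʳ ∣ S ∣)))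

    -- Choosing i first and then T above `S ∪ ⁅ i ⁆` amounts to choosing T above S and then i in the
    -- difference; heredity makes that i an extension.
    above-step : ∀ k S T i → χ S i * indicator (above? k (S ∪ ⁅ i ⁆) T) ≡
                 indicator (above? (suc k) S T) * indicator (InDifference? S T i)
    above-step k S T i = trans (indicator-× (extends? S i) (above? k (S ∪ ⁅ i ⁆) T))
      (trans (indicator-⇔ _ _ to from) (sym (indicator-× (above? (suc k) S T) (InDifference? S T i))))
      where
      to : Extends S i × Above k (S ∪ ⁅ i ⁆) T → Above (suc k) S T × (i ∈ T × i ∉ S)
      to ((i∉S , _) , ⊆T , indep , eq) =
        (⊆T ∘ p⊆p∪q ⁅ i ⁆ , indep , trans eq (trans (cong (_+ k) (∣p∪⁅x⁆∣ S i∉S)) (sym (+-suc ∣ S ∣ k)))) ,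
        ⊆T (q⊆p∪q S ⁅ i ⁆ (x∈⁅x⁆ i)) , i∉S
      from : Above (suc k) S T × (i ∈ T × i ∉ S) → Extends S i × Above k (S ∪ ⁅ i ⁆) T
      from ((S⊆T , indep , eq) , i∈T , i∉S) = (i∉S , hereditary Si⊆T indep) ,
        Si⊆T , indep , trans eq (trans (+-suc ∣ S ∣ k) (sym (cong (_+ k) (∣p∪⁅x⁆∣ S i∉S))))
        where
        Si⊆T : S ∪ ⁅ i ⁆ ⊆ T
        Si⊆T = ∪-least S⊆T (⁅⁆-⊆ i∈T)

    -- Double counting of the pairs (i , T) with S ∪ ⁅ i ⁆ ⊆ T and i ∉ S.
    numAbove-suc : ∀ k S → sum (λ i → χ S i * numAbove k (S ∪ ⁅ i ⁆)) ≡ suc k * numAbove (suc k) S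
    numAbove-suc k S = begin
      sum (λ i → χ S i * numAbove k (S ∪ ⁅ i ⁆))
        ≡⟨ sum-cong-≗ (λ i → listSum-*ˡ (allSubsets m) (χ S i) (λ T → indicator (above? k (S ∪ ⁅ i ⁆) T))) ⟨
      sum (λ i → listSum (allSubsets m) (λ T → χ S i * indicator (above? k (S ∪ ⁅ i ⁆) T)))
        ≡⟨ ∑-listSum-comm (allSubsets m) (λ i T → χ S i * indicator (above? k (S ∪ ⁅ i ⁆) T)) ⟩
      listSum (allSubsets m) (λ T → sum (λ i → χ S i * indicator (above? k (S ∪ ⁅ i ⁆) T)))
        ≡⟨ listSum-cong (allSubsets m) inner ⟩
      listSum (allSubsets m) (λ T → suc k * indicator (above? (suc k) S T))
        ≡⟨ listSum-*ˡ (allSubsets m) (suc k) (λ T → indicator (above? (suc k) S T)) ⟩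
      suc k * numAbove (suc k) S ∎
      where
      open ≡-Reasoning
      size : ∀ T (A? : Dec (Above (suc k) S T)) →
        indicator A? * sum (λ i → indicator (InDifference? S T i)) ≡ suc k * indicator A?
      size T (no _) = sym (*-zeroʳ (suc k))
      size T (yes (S⊆T , _ , eq)) = trans (*-identityˡ _) (trans
        (+-cancelˡ-≡ ∣ S ∣ _ (suc k) (trans (sym (∣T∣≡∣S∣+∑ S⊆T)) eq)) (sym (*-identityʳ (suc k))))
      inner : ∀ T → sum (λ i → χ S i * indicator (above? k (S ∪ ⁅ i ⁆) T)) ≡
                    suc k * indicator (above? (suc k) S T)
      inner T = trans (sum-cong-≗ (above-step k S T))
        (trans (sym (*-distribˡ-sum (indicator (above? (suc k) S T)) (λ i → indicator (InDifference? S T i))))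
          (size T (above? (suc k) S T)))

    -- Each T is reached through any of its `suc k` new elements as the first, and in k! orders
    -- after that. Independence of S enters at k = 0, where S itself is counted.
    orderedExtensions≡ : ∀ k {S} → Indep S → orderedExtensions k S ≡ k ! * numAbove k S
    orderedExtensions≡ zero    indep = sym (trans (*-identityˡ _) (numAbove-zero indep))
    orderedExtensions≡ (suc k) {S} indep = begin
      sum (λ i → χ S i * orderedExtensions k (S ∪ ⁅ i ⁆))
        ≡⟨ sum-cong-≗ (λ i → term i (extends? S i)) ⟩
      sum (λ i → k ! * (χ S i * numAbove k (S ∪ ⁅ i ⁆)))
        ≡⟨ *-distribˡ-sum (k !) (λ i → χ S i * numAbove k (S ∪ ⁅ i ⁆)) ⟨
      k ! * sum (λ i → χ S i * numAbove k (S ∪ ⁅ i ⁆))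
        ≡⟨ cong (k ! *_) (numAbove-suc k S) ⟩
      k ! * (suc k * numAbove (suc k) S)
        ≡⟨ rearr (k !) (suc k) (numAbove (suc k) S) ⟩
      suc k * k ! * numAbove (suc k) S ∎
      where
      open ≡-Reasoning
      rearr : ∀ f s n → f * (s * n) ≡ s * f * n
      rearr = solve-∀
      swap : ∀ x f n → x * (f * n) ≡ f * (x * n)
      swap = solve-∀
      -- The induction hypothesis requires `S ∪ ⁅ i ⁆` to be independent; when i does not extend S,
      -- both sides are zero.
      term : ∀ i (E? : Dec (Extends S i)) → indicator E? * orderedExtensions k (S ∪ ⁅ i ⁆) ≡
             k ! * (indicator E? * numAbove k (S ∪ ⁅ i ⁆))
      term i (no _) = sym (*-zeroʳ (k !))
      term i (yes (_ , indep)) = trans (cong (1 *_) (orderedExtensions≡ k indep))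
        (swap 1 (k !) (numAbove k (S ∪ ⁅ i ⁆)))

    orderedExtensions-⊥ : ∀ k → orderedExtensions k ⊥ ≡ k ! * numIndep M k
    orderedExtensions-⊥ k = trans (orderedExtensions≡ k indep-⊥) (cong (k ! *_) (numAbove-⊥ k))

    -- Ordered log-concavity at ⊥ carries factorials. They cancel because (k+1)!² ≤ k! (k+2)!, which
    -- gives away the extra factor (k+2)/(k+1).
    numIndep-logConcave : ∀ k → numIndep M k * numIndep M (suc (suc k)) ≤ numIndep M (suc k) * numIndep M (suc k)
    numIndep-logConcave k = *-cancelˡ-≤ (F * F) (≤-trans
        (*-monoˡ-≤ (I k * I (2 + k)) F²≤)
        (subst₂ _≤_
          (trans (cong₂ _*_ (orderedExtensions-⊥ k) (orderedExtensions-⊥ (2 + k))) (rearr (k !) (I k) ((2 + k) !) (I (2 + k))))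
          (trans (cong₂ _*_ (orderedExtensions-⊥ (suc k)) (orderedExtensions-⊥ (suc k))) (rearr F (I (suc k)) F (I (suc k))))
          (orderedExtensions-logConcave k ⊥)))
      where
      I : ℕ → ℕ
      I = numIndep M
      F : ℕ
      F = suc k !
      instance
        F*F≢0 = m*n≢0 F F ⦃ suc k !≢0 ⦄ ⦃ suc k !≢0 ⦄
      rearr : ∀ a b c d → a * b * (c * d) ≡ a * c * (b * d)
      rearr = solve-∀
      F²≤ : F * F ≤ k ! * (2 + k) !
      F²≤ = subst (F * F ≤_) (swap (2 + k) (k !) F) (*-monoˡ-≤ F (*-monoˡ-≤ (k !) (n≤1+n (suc k))))
        where
        swap : ∀ s f g → s * f * g ≡ f * (s * g)
        swap = solve-∀

open import Data.Nat using (ℕ; suc; _∸_; _*_; _^_; _≤_)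

theorem3p3p17 : {ℓ : Level} {m : ℕ} (M : Matroid m ℓ) (n : ℕ) → rank M ≡ n →
    (k : ℕ) → 2 ≤ k → k ≤ n ∸ 1 →
    numIndep M (k ∸ 1) * numIndep M (suc k) ≤ numIndep M k ^ 2
-- With the index a successor, `k ∸ 1` computes; the square unfolds to a product with a trailing
-- factor 1, which is removed.
theorem3p3p17 M n _ (suc k) _ _ = subst (numIndep M k * numIndep M (suc (suc k)) ≤_)
  (cong (numIndep M (suc k) *_) (sym (ℕ.*-identityʳ (numIndep M (suc k)))))
  (IndependentSetCounts.Counting.numIndep-logConcave M k)
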